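{- In the setting described in the context (for any positive integer $p$), the permutations $\xi_1,\dots,\xi_{n+1}$ of $\mathcal{F}^w(\mathcal{T})\times\mathbb{Z}_{3p}$ satisfy $\xi_{n+1}^2=1$ and $(\xi_i^{ -1}\xi_{n+1})^2=1$ for all $1\le i\le n-1$.
   Context: Let $n\ge2$, $k\in\{1,2,n\}$, and $a\ge 6n+1$ an integer. Let $\Lambda$ be $a\mathbb{Z}^n$ if $k=1$, $a\{x\in\mathbb{Z}^n:\sum x_i\text{ even}\}$ if $k=2$, $a\{x\in\mathbb{Z}^n:\text{all }x_i\text{ of equal parity}\}$ if $k=n$, and let $\mathcal{T}=\{4,3^{n-2},4\}_{(a^k,0^{n-k})}$ be the regular cubic toroid (quotient of the cubic tessellation of $\mathbb{E}^n$ by translations in $\Lambda$). Its flags are identified with triples $(\sigma,\mathbf{x},t)\in S_n\times\{\pm1\}^n\times(\mathbb{Z}^n/\Lambda)$, base flag $\Phi_0=(\mathrm{id},(1,\dots,1),0)$. Permutations act on the right on $\{1,\dots,n\}$ with $j(\sigma\tau)=(j\sigma)\tau$; $\mathbf{x}^{(i)}$ is $\mathbf{x}$ with $i$-th coordinate negated; $e_i$ standard basis vectors. Monodromy permutations (acting on the left): $r_0(\sigma,\mathbf{x},t)=(\sigma,\mathbf{x}^{(1\sigma)},t)$; $r_i(\sigma,\mathbf{x},t)=((i\ i{+}1)\sigma,\mathbf{x},t)$ for $1\le i\le n-1$; $r_n(\sigma,\mathbf{x},t)=(\sigma,\mathbf{x}^{(n\sigma)},t-x_{n\sigma}e_{n\sigma})$.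 The facet of $(\sigma,\mathbf{x},t)$ is identified with $t$. A flag is white iff $\mathrm{sgn}(\sigma)\prod_i x_i=1$; $\mathcal{F}^w(\mathcal{T})$ is the set of white flags. For $\Phi=(\sigma,\mathbf{x},t)$ put $\hat\Phi=(\sigma,-\mathbf{x},t)$. Let $v_0=(1,2,\dots,n)$ and let $h$ be the permutation of flags $h(\sigma,\mathbf{x},t)=(\sigma,\mathbf{x},t+(x_1(v_0)_{1\sigma^{ -1}},\dots,x_n(v_0)_{n\sigma^{ -1}}))$, and $\bar h=r_0hr_0$. For $i\in\{0,\pm1,\pm2,\pm3\}$ let $\Phi_i=h^i\Phi_0$ and $F_i$ its facet (so $F_i=iv_0$). A flag $(\sigma,\mathbf{x},t)$ contains the vertex $X_H$ iff $t\equiv(0,-3,0,\dots,0)+(\delta_1,\dots,\delta_n)$ with $\delta_j=-1$ if $x_j=-1$ and $\delta_j=0$ otherwise; the facets incident to $X_H$ are $(0,-3,0,\dots,0)+\varepsilon$, $\varepsilon\in\{0,-1\}^n$. Let $p$ be a positive integer, and $H=\{(F,1): F \text{ a facet incident to } X_H\}\subset\{\text{facets}\}\times\mathbb{Z}_{3p}$. For a facet $F$ and $\ell\in\mathbb{Z}_{3p}$ the root flag $\Phi_F=\Phi_{F,\ell}$ (a white flag with facet $F$) is given by the first applicable rule: (1) if $F=F_i$ with $i\in\{0,\pm1,\pm2,\pm3\}$, $\Phi_F=\Phi_i$; (2) if $\ell\not\equiv1\pmod 3$ and $F$ is the facet of $\bar h^j\Phi$ for some white flag $\Phi$ with facet $F_0$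 and $j\in\{\pm1,\pm2,\pm3\}$, $\Phi_F=\bar h^j\Phi$; (3) if $(F,\ell)\in H$, $\Phi_F$ is a fixed chosen white flag containing $F$ and $X_H$; (4) otherwise $\Phi_F=(\mathrm{id},(1,\dots,1),F)$. For $i\in\{0,1\}$ let $\rho_i^{(F,\ell)}$ be the unique permutation (written on the right) of the flags with facet $F$ that commutes with $r_0,\dots,r_{n-1}$ and maps $\Phi_F$ to $r_i\Phi_F$. Define $\rho^\ell$ on flags by $\rho^\ell\Phi=\Phi\rho_0^{(F,\ell)}$ if $(F,\ell)\notin H$ and $\rho^\ell\Phi=\Phi\rho_1^{(F,\ell)}$ if $(F,\ell)\in H$, $F$ the facet of $\Phi$. Define permutations of $\mathcal{F}^w(\mathcal{T})\times\mathbb{Z}_{3p}$: $\xi_i(\Phi,\ell)=(r_0r_i\Phi,\ell)$ for $1\le i\le n$, and $\xi_{n+1}(\Phi,\ell)=(\rho^\ell r_0\Phi,\ell+1)$ if ($F_1\in\Phi$ and $\ell\equiv0$) or ($F_3\in\Phi$ and $\ell\equiv1$) or ($F_0\in\Phi$ and $\ell\equiv2$) mod 3; $\xi_{n+1}(\Phi,\ell)=(\rho^\ell r_0\Phi,\ell-1)$ if ($F_0\in\Phi$ and $\ell\equiv0$) or ($F_1\in\Phi$ and $\ell\equiv1$) or ($F_3\in\Phi$ and $\ell\equiv2$) mod 3; and $\xi_{n+1}(\Phi,\ell)=(\rho^\ell r_0\Phi,\ell)$ otherwise. Here "$F\in\Phi$" means $F$ is the facet of $\Phi$. -}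

module Defs where

open import Data.Nat as ℕ using (ℕ; zero; suc; NonZero; _<_; _≡ᵇ_)
open import Data.Nat.Properties using (m*n≢0)
open import Data.Integer as ℤ using (ℤ; +_; -[1+_]; _◃_; _/ℕ_; _%ℕ_)
open import Data.Sign as Sign using (Sign)
open import Data.Bool using (Bool; true; false; if_then_else_; _∧_; _∨_; not; T)
open import Data.Fin as Fin using (Fin; toℕ)
open import Data.Fin.Properties using (all?; any?)
open import Data.Fin.Permutation as P using (Permutation′; _⟨$⟩ʳ_; _⟨$⟩ˡ_; _∘ₚ_; transpose)
open import Data.List using (List; []; _∷_; foldr; length; filter; concatMap; map)
open import Data.List.Membership.Propositional using (_∈_)
open import Data.Product using (Σ; _×_; _,_; proj₁; proj₂)
open import Data.Sum using (_⊎_)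
open import Relation.Nullary using (¬_; Dec; yes; no)
open import Relation.Nullary.Decidable using (⌊_⌋)
open import Relation.Binary.PropositionalEquality using (_≡_; _≢_)

------------------------------------------------------------------------
-- The three kinds of lattices Λ : k = 1, k = 2, k = n.

data KType : Set where
  k1 k2 kn : KType

-- Boolean equality of natural numbers
_==_ : ℕ → ℕ → Bool
_==_ = _≡ᵇ_

------------------------------------------------------------------------
-- The whole setting, for n = 2 + M (so n ≥ 2), parameters k, a (a ≠ 0),
-- p (p ≠ 0).  We write N = n - 1 = suc M.

module Setting (M : ℕ) (k : KType) (a : ℕ) .{{a≢0 : NonZero a}}
               (p : ℕ) .{{p≢0 : NonZero p}} where

  N : ℕ
  N = suc M

  n : ℕ
  n = suc N

  -- vectors of ℤ^n (representatives of elements of ℤ^n / Λ)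
  Vecℤ : Set
  Vecℤ = Fin n → ℤ

  _⊕_ : Vecℤ → Vecℤ → Vecℤ
  (u ⊕ v) j = u j ℤ.+ v j

  _⊖_ : Vecℤ → Vecℤ → Vecℤ
  (u ⊖ v) j = u j ℤ.- v j

  zeroV : Vecℤ
  zeroV j = + 0

  -- scalar multiple
  _·_ : ℤ → Vecℤ → Vecℤ
  (c · v) j = c ℤ.* v j

  allB : (Fin n → Bool) → Bool
  allB f = foldr _∧_ true (map f (Data.List.allFin n))
    where import Data.List

  parity : ℤ → ℕ
  parity z = z %ℕ 2

  sumℤ : Vecℤ → ℤ
  sumℤ v = foldr ℤ._+_ (+ 0) (map v (Data.List.allFin n))
    where import Data.List

  -- Membership in Λ (decided).  v ∈ Λ iff v = a·y with y ∈ ℤ^n and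
  --   k = 1 : no further condition
  --   k = 2 : Σ y_i even
  --   k = n : all y_i of equal parity
  -- Here y_i = v_i / a, which is exact once a ∣ v_i for all i.
  inΛ : Vecℤ → Bool
  inΛ v = allB (λ j → (v j %ℕ a) == 0) ∧ cond k
    where
      y : Vecℤ
      y j = v j /ℕ a
      cond : KType → Bool
      cond k1 = true
      cond k2 = parity (sumℤ y) == 0
      cond kn = allB (λ j → parity (y j) == parity (y Fin.zero))

  -- equality in ℤ^n / Λ
  _≈Λ_ : Vecℤ → Vecℤ → Set
  u ≈Λ v = T (inΛ (u ⊖ v))

  _≈Λ?_ : Vecℤ → Vecℤ → Bool
  u ≈Λ? v = inΛ (u ⊖ v)

  ----------------------------------------------------------------------
  -- Flags (σ , x , t); permutations act on the right: j σ = σ ⟨$⟩ʳ j,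
  -- and j (σ τ) = (j σ) τ, i.e. σ τ = σ ∘ₚ τ.  Signs x_i ∈ {±1} are
  -- elements of Sign.  Index j : Fin n stands for j+1 ∈ {1,…,n}.

  record Flag : Set where
    constructor flag
    field
      σ : Permutation′ n
      x : Fin n → Sign
      t : Vecℤ
  open Flag public

  Facet : Set
  Facet = Vecℤ

  facet : Flag → Facet
  facet Φ = t Φ

  -- equality of flags of the toroid
  _≈F_ : Flag → Flag → Set
  Φ ≈F Ψ = (∀ j → σ Φ ⟨$⟩ʳ j ≡ σ Ψ ⟨$⟩ʳ j) × (∀ j → x Φ j ≡ x Ψ j) × (t Φ ≈Λ t Ψ)

  -- x^{(i)} : negate the i-th coordinate
  negAt : Fin n → (Fin n → Sign) → (Fin n → Sign)
  negAt i s j = if ⌊ j Fin.≟ i ⌋ then Sign.opposite (s j) else s j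

  -- sign of a permutation: (-1)^(number of inversions)
  inversions : Permutation′ n → ℕ
  inversions π = length (filter (λ ij → ℕ._<?_ (toℕ (π ⟨$⟩ʳ proj₂ ij)) (toℕ (π ⟨$⟩ʳ proj₁ ij)))
                         (filter (λ ij → ℕ._<?_ (toℕ (proj₁ ij)) (toℕ (proj₂ ij)))
                            (concatMap (λ i → map (λ j → (i , j)) (Data.List.allFin n)) (Data.List.allFin n))))
    where import Data.List

  sgn : Permutation′ n → Sign
  sgn π = if (inversions π ℕ.% 2) == 0 then Sign.+ else Sign.-

  prodSign : (Fin n → Sign) → Sign
  prodSign s = foldr Sign._*_ Sign.+ (map s (Data.List.allFin n))
    where import Data.List

  White : Flag → Set
  White Φ = sgn (σ Φ) Sign.* prodSign (x Φ) ≡ Sign.+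

  -- base flag Φ₀ = (id, (1,…,1), 0)
  Φ₀ : Flag
  Φ₀ = flag P.id (λ _ → Sign.+) zeroV

  ----------------------------------------------------------------------
  -- Monodromy r₀, r₁, …, r_{n-1}  (r_n is not needed here)

  r₀ : Flag → Flag
  r₀ (flag s y u) = flag s (negAt (s ⟨$⟩ʳ Fin.zero) y) u

  -- r_{i+1} for i : Fin N, i.e. r_m for m = 1, …, n-1 ;
  -- swaps m and m+1, i.e. Fin-indices inject₁ i and suc i
  rₛ : Fin N → Flag → Flag
  rₛ i (flag s y u) = flag (transpose (Fin.inject₁ i) (Fin.suc i) ∘ₚ s) y u

  -- r_m for m ∈ {0, …, n-1}
  r : Fin n → Flag → Flag
  r Fin.zero    = r₀
  r (Fin.suc i) = rₛ i

  ----------------------------------------------------------------------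
  -- h, h̄ and their powers

  -- v₀ = (1, …, n) : (v₀)_m for Fin-index m is toℕ m + 1
  hvec : Flag → Vecℤ
  hvec (flag s y u) j = y j ◃ suc (toℕ (s ⟨$⟩ˡ j))

  h : Flag → Flag
  h Φ = flag (σ Φ) (x Φ) (t Φ ⊕ hvec Φ)

  h⁻¹ : Flag → Flag
  h⁻¹ Φ = flag (σ Φ) (x Φ) (t Φ ⊖ hvec Φ)

  iter : ℕ → (Flag → Flag) → Flag → Flag
  iter zero f Φ = Φ
  iter (suc m) f Φ = f (iter m f Φ)

  -- integer powers of a permutation given together with its inverse
  pow : (Flag → Flag) → (Flag → Flag) → ℤ → Flag → Flag
  pow f g (+ m) = iter m f
  pow f g -[1+ m ] = iter (suc m) g

  hbar : Flag → Flag
  hbar Φ = r₀ (h (r₀ Φ))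

  hbar⁻¹ : Flag → Flag
  hbar⁻¹ Φ = r₀ (h⁻¹ (r₀ Φ))

  h^ : ℤ → Flag → Flag
  h^ = pow h h⁻¹

  hbar^ : ℤ → Flag → Flag
  hbar^ = pow hbar hbar⁻¹

  -- Φ_i = h^i Φ₀ and F_i its facet
  Φ_ : ℤ → Flag
  Φ_ i = h^ i Φ₀

  F_ : ℤ → Facet
  F_ i = facet (Φ_ i)

  -- i ∈ {0, ±1, ±2, ±3} and j ∈ {±1, ±2, ±3}
  I₇ : List ℤ
  I₇ = + 0 ∷ + 1 ∷ ℤ.- + 1 ∷ + 2 ∷ ℤ.- + 2 ∷ + 3 ∷ ℤ.- + 3 ∷ []

  J₆ : List ℤ
  J₆ = + 1 ∷ ℤ.- + 1 ∷ + 2 ∷ ℤ.- + 2 ∷ + 3 ∷ ℤ.- + 3 ∷ []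

  ----------------------------------------------------------------------
  -- The vertex X_H and the set H

  -- c = (0, -3, 0, …, 0)
  cH : Vecℤ
  cH j = if toℕ j == 1 then ℤ.- + 3 else + 0

  -- δ(x)_j = -1 if x_j = -1, 0 otherwise
  δ : (Fin n → Sign) → Vecℤ
  δ y j with y j
  ... | Sign.- = ℤ.- + 1
  ... | Sign.+ = + 0

  ContainsXH : Flag → Set
  ContainsXH Φ = t Φ ≈Λ (cH ⊕ δ (x Φ))

  -- all ε ∈ {0,-1}^n
  epsilons : (m : ℕ) → List (Fin m → ℤ)
  epsilons zero = (λ ()) ∷ []
  epsilons (suc m) = concatMap (λ e → (λ { Fin.zero → + 0 ; (Fin.suc j) → e j })
                                    ∷ (λ { Fin.zero → ℤ.- + 1 ; (Fin.suc j) → e j }) ∷ [])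
                               (epsilons m)

  anyL : {A : Set} → (A → Bool) → List A → Bool
  anyL f = foldr (λ z b → f z ∨ b) false

  -- F is incident to X_H : F ≡ (0,-3,0,…,0) + ε mod Λ for some ε ∈ {0,-1}^n
  incXH? : Facet → Bool
  incXH? F = anyL (λ ε → F ≈Λ? (cH ⊕ ε)) (epsilons n)

  -- (F , ℓ) ∈ H
  inH? : Facet → ℕ → Bool
  inH? F ℓ = incXH? F ∧ (ℓ == 1)

  InH : Facet → ℕ → Set
  InH F ℓ = T (inH? F ℓ)

  ----------------------------------------------------------------------
  -- ℤ_{3p}, represented by ℓ ∈ ℕ with ℓ < 3p

  m₃ₚ : ℕ
  m₃ₚ = 3 ℕ.* p

  instance
    m₃ₚ≢0 : NonZero m₃ₚ
    m₃ₚ≢0 = m*n≢0 3 p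

  inc : ℕ → ℕ
  inc ℓ = suc ℓ ℕ.% m₃ₚ

  dec : ℕ → ℕ
  dec ℓ = (ℓ ℕ.+ (m₃ₚ ℕ.∸ 1)) ℕ.% m₃ₚ

  _≡₃_ : ℕ → ℕ → Bool
  ℓ ≡₃ c = (ℓ ℕ.% 3) == c

  ----------------------------------------------------------------------
  -- Root flags Φ_{F,ℓ}: specification by the "first applicable rule"

  Rule1 : Facet → Set
  Rule1 F = Σ ℤ λ i → i ∈ I₇ × F ≈Λ F_ i

  Rule2Wit : Facet → Flag → ℤ → Set
  Rule2Wit F Φ j = White Φ × facet Φ ≈Λ F_ (+ 0) × j ∈ J₆ × facet (hbar^ j Φ) ≈Λ F

  Rule2 : Facet → ℕ → Set
  Rule2 F ℓ = ¬ (ℓ ℕ.% 3 ≡ 1) × Σ Flag λ Φ → Σ ℤ λ j → Rule2Wit F Φ j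

  RootSpec : (Facet → ℕ → Flag) → Set
  RootSpec root = ∀ F ℓ → ℓ < m₃ₚ →
      -- (1)
      (∀ i → i ∈ I₇ → F ≈Λ F_ i → root F ℓ ≈F Φ_ i)
      -- (2)
    × (¬ Rule1 F → Rule2 F ℓ →
         Σ Flag λ Φ → Σ ℤ λ j → Rule2Wit F Φ j × root F ℓ ≈F hbar^ j Φ)
      -- (3)
    × (¬ Rule1 F → ¬ Rule2 F ℓ → InH F ℓ →
         White (root F ℓ) × facet (root F ℓ) ≈Λ F × ContainsXH (root F ℓ))
      -- (4)
    × (¬ Rule1 F → ¬ Rule2 F ℓ → ¬ InH F ℓ →
         root F ℓ ≈F flag P.id (λ _ → Sign.+) F)
      -- Φ_{F,ℓ} depends only on the facet F (an element of ℤ^n/Λ)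
    × (∀ F' → F ≈Λ F' → root F ℓ ≈F root F' ℓ)

  ----------------------------------------------------------------------
  -- ρ_i^{(F,ℓ)} (i ∈ {0,1}, encoded as Fin 2): the (unique) permutation
  -- of the flags with facet F commuting with r₀,…,r_{n-1} and mapping
  -- Φ_F to r_i Φ_F.  (Written here as a function Flag → Flag, only its
  -- values on flags with facet F matter.)

  -- r₀ for i = 0 and r₁ for i = 1
  r₀₁ : Fin 2 → Flag → Flag
  r₀₁ Fin.zero = r₀
  r₀₁ (Fin.suc Fin.zero) = rₛ Fin.zero

  RhoSpec : (Facet → ℕ → Flag) → (Fin 2 → Facet → ℕ → Flag → Flag) → Set
  RhoSpec root ρ = ∀ (i : Fin 2) F ℓ → ℓ < m₃ₚ →
      -- maps flags with facet F to flags with facet F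
      (∀ Ψ → facet Ψ ≈Λ F → facet (ρ i F ℓ Ψ) ≈Λ F)
      -- commutes with r₀,…,r_{n-1}
    × (∀ Ψ → facet Ψ ≈Λ F → ∀ m → ρ i F ℓ (r m Ψ) ≈F r m (ρ i F ℓ Ψ))
      -- maps Φ_F to r_i Φ_F
    × (ρ i F ℓ (root F ℓ) ≈F r₀₁ i (root F ℓ))
      -- well defined on flags and on facets (elements of ℤ^n/Λ)
    × (∀ Ψ Ψ' → facet Ψ ≈Λ F → Ψ ≈F Ψ' → ρ i F ℓ Ψ ≈F ρ i F ℓ Ψ')
    × (∀ F' Ψ → F ≈Λ F' → facet Ψ ≈Λ F → ρ i F ℓ Ψ ≈F ρ i F' ℓ Ψ)

  ----------------------------------------------------------------------
  -- ρ^ℓ and the permutations ξ of F^w(T) × ℤ_{3p}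

  module _ (ρ : Fin 2 → Facet → ℕ → Flag → Flag) where

    ρ^ : ℕ → Flag → Flag
    ρ^ ℓ Φ = if inH? (facet Φ) ℓ then ρ (Fin.suc Fin.zero) (facet Φ) ℓ Φ
                                 else ρ Fin.zero (facet Φ) ℓ Φ

    -- ξ_m for m = 1, …, n-1 (given by i : Fin N, m = toℕ i + 1)
    ξ : Fin N → Flag × ℕ → Flag × ℕ
    ξ i (Φ , ℓ) = (r₀ (rₛ i Φ) , ℓ)

    ξₙ₊₁ : Flag × ℕ → Flag × ℕ
    ξₙ₊₁ (Φ , ℓ) =
      if (F ≈Λ? F_ (+ 1) ∧ ℓ ≡₃ 0) ∨ (F ≈Λ? F_ (+ 3) ∧ ℓ ≡₃ 1) ∨ (F ≈Λ? F_ (+ 0) ∧ ℓ ≡₃ 2)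
        then (Ψ , inc ℓ)
      else if (F ≈Λ? F_ (+ 0) ∧ ℓ ≡₃ 0) ∨ (F ≈Λ? F_ (+ 1) ∧ ℓ ≡₃ 1) ∨ (F ≈Λ? F_ (+ 3) ∧ ℓ ≡₃ 2)
        then (Ψ , dec ℓ)
      else (Ψ , ℓ)
      where
        F = facet Φ
        Ψ = ρ^ ℓ (r₀ Φ)

  -- equality in F^w(T) × ℤ_{3p}
  _≈_ : Flag × ℕ → Flag × ℕ → Set
  (Φ , ℓ) ≈ (Ψ , ℓ') = Φ ≈F Ψ × ℓ ≡ ℓ'

  -- elements of F^w(T) × ℤ_{3p}
  Elt : Flag × ℕ → Set
  Elt (Φ , ℓ) = White Φ × ℓ < m₃ₚ

  ----------------------------------------------------------------------
  -- The claim of Proposition 6.8.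
  --   ξ_{n+1}² = 1, and (ξ_i⁻¹ ξ_{n+1})² = 1 for 1 ≤ i ≤ n-1, the latter
  --   phrased via: if ξ_i w₁ = ξ_{n+1} z and ξ_i w₂ = ξ_{n+1} w₁ (i.e.
  --   w₁ = ξ_i⁻¹ ξ_{n+1} z, w₂ = ξ_i⁻¹ ξ_{n+1} w₁) then w₂ = z.

  Claim : Set
  Claim = (root : Facet → ℕ → Flag) → RootSpec root →
          (ρ : Fin 2 → Facet → ℕ → Flag → Flag) → RhoSpec root ρ →
            (∀ z → Elt z → ξₙ₊₁ ρ (ξₙ₊₁ ρ z) ≈ z)
          × (∀ (i : Fin N) z w₁ w₂ → Elt z → Elt w₁ → Elt w₂ →
               ξ ρ i w₁ ≈ ξₙ₊₁ ρ z → ξ ρ i w₂ ≈ ξₙ₊₁ ρ w₁ → w₂ ≈ z)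

-- ξₙ₊₁ maps (Φ , ℓ) to (ρ^ℓ (r₀ Φ) , ℓ') and changes the level only on the facets F₀, F₁, F₃.
-- Each ρ_i^{(F,ℓ)} commutes with r₀, …, r_{n-1}, and these act transitively on the flags of F,
-- so ρ_i^{(F,ℓ)} is determined by its value r_i Φ_F at the root flag: it is an involution, and
-- on the facets F₀, F₁, F₃, whose root flags Φ₀, Φ₁, Φ₃ do not depend on ℓ, it does not depend
-- on ℓ either.  As a > 10 these three facets are distinct and not incident to X_H, so there
-- ρ^ℓ = ρ₀ for every ℓ, and the level update swaps two residues modulo 3.  Hence
-- ξₙ₊₁² (Φ , ℓ) = (ρ r₀ ρ r₀ Φ , ℓ) = (r₀ ρ² r₀ Φ , ℓ) = (Φ , ℓ), and (ξᵢ⁻¹ ξₙ₊₁)² = 1 follows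
-- in the same way by moving ρ past r₀ rᵢ r₀.

module Submission where

open import Defs
open import Data.Nat using (ℕ; suc; _≤_; _+_; _*_; NonZero)

open import Data.Nat as ℕ using (zero; z≤n; s≤s)
import Data.Nat.Properties as ℕ
open import Data.Integer as ℤ using (ℤ; +_; -[1+_]; _%ℕ_; _/ℕ_)
import Data.Integer.Properties as ℤ
open import Data.Nat.DivMod using (m%n<n)
open import Data.Integer.DivMod using (a≡a%ℕn+[a/ℕn]*n; n%ℕd<d)
open import Data.Integer.Solver using () renaming (module +-*-Solver to ℤ-Solver)
open import Algebra.Properties.AbelianGroup ℤ.+-0-abelianGroup using (∙-cancelʳ)
open import Data.Bool using (Bool; true; false; T; _∧_; _∨_; if_then_else_)
open import Data.Bool.Properties using (T-∧; T-∨)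
open import Data.Empty using (⊥; ⊥-elim)
open import Data.Unit using (⊤; tt)
open import Data.Fin as Fin using (Fin; toℕ)
import Data.Fin.Properties as Fin
import Data.Fin.Permutation.Components as PC
open import Data.List using (List; []; _∷_; foldr; map; allFin)
open import Data.List.Membership.Propositional using (_∈_)
open import Data.List.Membership.Propositional.Properties using (∈-allFin)
open import Data.List.Relation.Unary.Any as Any using (Any; here; there)
open import Data.List.Relation.Unary.All as All using (All; []; _∷_)
import Data.List.Relation.Unary.All.Properties as All
open import Data.Product using (Σ; ∃; _×_; _,_; proj₁; proj₂)
open import Data.Sum using (_⊎_; inj₁; inj₂)
open import Function using (Equivalence; _∘_)
open import Relation.Binary.Definitions using (tri<; tri≈; tri>)
open import Relation.Binary.PropositionalEquality
open import Relation.Nullary using (¬_; Dec; yes; no)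
open import Relation.Nullary.Decidable using (decidable-stable; T?)
open import Relation.Binary.Bundles using (Setoid)
import Relation.Binary.Reasoning.Setoid as SetoidReasoning
open import Level using (0ℓ)
open import Data.Sign as Sign using (Sign)
import Data.Sign.Properties as Sign
open import Data.Fin.Permutation as Perm using (Permutation′; _⟨$⟩ʳ_; _⟨$⟩ˡ_; _∘ₚ_; transpose)

open Equivalence using (to; from)

T-∧-intro : ∀ {b c} → T b → T c → T (b ∧ c)
T-∧-intro {b} {c} tb tc = from (T-∧ {b} {c}) (tb , tc)

T-∧-elim : ∀ {b c} → T (b ∧ c) → T b × T c
T-∧-elim {b} {c} = to (T-∧ {b} {c})

T-extensional : ∀ {b c} → (T b → T c) → (T c → T b) → b ≡ c
T-extensional {false} {false} _ _ = refl
T-extensional {false} {true}  _ g = ⊥-elim (g tt)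
T-extensional {true}  {false} f _ = ⊥-elim (f tt)
T-extensional {true}  {true}  _ _ = refl

T-foldr-∧ : ∀ {A : Set} (f : A → Bool) L → T (foldr _∧_ true (map f L)) → ∀ {x} → x ∈ L → T (f x)
T-foldr-∧ f (y ∷ L) h (here refl) = proj₁ (T-∧-elim {f y} h)
T-foldr-∧ f (y ∷ L) h (there x∈L) = T-foldr-∧ f L (proj₂ (T-∧-elim {f y} h)) x∈L

foldr-∧-T : ∀ {A : Set} (f : A → Bool) L → (∀ x → T (f x)) → T (foldr _∧_ true (map f L))
foldr-∧-T f []      h = tt
foldr-∧-T f (y ∷ L) h = T-∧-intro {f y} (h y) (foldr-∧-T f L h)

module Transposition {m : ℕ} (i j : Fin m) where

  transpose-left : PC.transpose i j i ≡ j
  transpose-left with i Fin.≟ i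
  ... | yes _ = refl
  ... | no i≢i = ⊥-elim (i≢i refl)

  transpose-right : PC.transpose i j j ≡ i
  transpose-right with j Fin.≟ i
  ... | yes j≡i = j≡i
  ... | no _ with j Fin.≟ j
  ...   | yes _ = refl
  ...   | no j≢j = ⊥-elim (j≢j refl)

  transpose-other : ∀ {l} → l ≢ i → l ≢ j → PC.transpose i j l ≡ l
  transpose-other {l} l≢i l≢j with l Fin.≟ i
  ... | yes l≡i = ⊥-elim (l≢i l≡i)
  ... | no _ with l Fin.≟ j
  ...   | yes l≡j = ⊥-elim (l≢j l≡j)
  ...   | no _ = refl

  transpose-involutive : ∀ l → PC.transpose i j (PC.transpose i j l) ≡ l
  transpose-involutive l with l Fin.≟ i
  ... | yes refl = transpose-right
  ... | no l≢i with l Fin.≟ j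
  ...   | yes refl = transpose-left
  ...   | no l≢j = transpose-other l≢i l≢j

⟨$⟩ʳ-injective : ∀ {m} (π : Permutation′ m) {i j} → π ⟨$⟩ʳ i ≡ π ⟨$⟩ʳ j → i ≡ j
⟨$⟩ʳ-injective π {i} {j} eq = trans (sym (Perm.inverseˡ π {i})) (trans (cong (π ⟨$⟩ˡ_) eq) (Perm.inverseˡ π {j}))

opposite-≢ : ∀ {s s'} → s ≢ s' → Sign.opposite s ≡ s'
opposite-≢ {Sign.+} {Sign.+} s≢s' = ⊥-elim (s≢s' refl)
opposite-≢ {Sign.+} {Sign.-} _    = refl
opposite-≢ {Sign.-} {Sign.+} _    = refl
opposite-≢ {Sign.-} {Sign.-} s≢s' = ⊥-elim (s≢s' refl)

if-pair : ∀ {A B : Set} b c (x : A) (u v w : B) →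
          (if b then (x , u) else if c then (x , v) else (x , w)) ≡ (x , (if b then u else if c then v else w))
if-pair true  _     _ _ _ _ = refl
if-pair false true  _ _ _ _ = refl
if-pair false false _ _ _ _ = refl

module ModularArithmetic where

  open import Data.Nat.DivMod
  open import Data.Nat.Divisibility using (m∣m*n)
  open ≡-Reasoning

  [m%d+n]%d≡[m+n]%d : ∀ m n d .{{_ : NonZero d}} → (m ℕ.% d + n) ℕ.% d ≡ (m + n) ℕ.% d
  [m%d+n]%d≡[m+n]%d m n d = begin
    (m ℕ.% d + n) ℕ.% d               ≡⟨ %-distribˡ-+ (m ℕ.% d) n d ⟩
    (m ℕ.% d ℕ.% d + n ℕ.% d) ℕ.% d   ≡⟨ cong (λ r → (r + n ℕ.% d) ℕ.% d) (m%n%n≡m%n m d) ⟩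
    (m ℕ.% d + n ℕ.% d) ℕ.% d         ≡⟨ %-distribˡ-+ m n d ⟨
    (m + n) ℕ.% d                     ∎

  private
    m+[d∸1]+1≡m+d : ∀ m d .{{_ : NonZero d}} → m + (d ℕ.∸ 1) + 1 ≡ m + d
    m+[d∸1]+1≡m+d m d = trans (ℕ.+-assoc m (d ℕ.∸ 1) 1)
      (cong (λ r → m + r) (trans (ℕ.+-comm (d ℕ.∸ 1) 1) (ℕ.m+[n∸m]≡n (ℕ.>-nonZero⁻¹ d))))

  [[1+m]%d+[d∸1]]%d≡m : ∀ m d .{{_ : NonZero d}} → m ℕ.< d → (suc m ℕ.% d + (d ℕ.∸ 1)) ℕ.% d ≡ m
  [[1+m]%d+[d∸1]]%d≡m m d m<d = begin
    (suc m ℕ.% d + (d ℕ.∸ 1)) ℕ.% d  ≡⟨ [m%d+n]%d≡[m+n]%d (suc m) (d ℕ.∸ 1) d ⟩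
    (1 + m + (d ℕ.∸ 1)) ℕ.% d        ≡⟨ cong (ℕ._% d) (ℕ.+-comm 1 (m + (d ℕ.∸ 1))) ⟩
    (m + (d ℕ.∸ 1) + 1) ℕ.% d        ≡⟨ cong (ℕ._% d) (m+[d∸1]+1≡m+d m d) ⟩
    (m + d) ℕ.% d                    ≡⟨ [m+n]%n≡m%n m d ⟩
    m ℕ.% d                          ≡⟨ m<n⇒m%n≡m m<d ⟩
    m                                ∎

  [1+[m+[d∸1]]%d]%d≡m : ∀ m d .{{_ : NonZero d}} → m ℕ.< d → suc ((m + (d ℕ.∸ 1)) ℕ.% d) ℕ.% d ≡ m
  [1+[m+[d∸1]]%d]%d≡m m d m<d = begin
    (1 + (m + (d ℕ.∸ 1)) ℕ.% d) ℕ.% d  ≡⟨ cong (ℕ._% d) (ℕ.+-comm 1 _) ⟩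
    ((m + (d ℕ.∸ 1)) ℕ.% d + 1) ℕ.% d  ≡⟨ [m%d+n]%d≡[m+n]%d (m + (d ℕ.∸ 1)) 1 d ⟩
    (m + (d ℕ.∸ 1) + 1) ℕ.% d          ≡⟨ cong (ℕ._% d) (m+[d∸1]+1≡m+d m d) ⟩
    (m + d) ℕ.% d                      ≡⟨ [m+n]%n≡m%n m d ⟩
    m ℕ.% d                            ≡⟨ m<n⇒m%n≡m m<d ⟩
    m                                  ∎

  [m%3p]%3≡m%3 : ∀ m p .{{_ : NonZero p}} .{{_ : NonZero (3 * p)}} → m ℕ.% (3 * p) ℕ.% 3 ≡ m ℕ.% 3
  [m%3p]%3≡m%3 m p = m∣n⇒o%n%m≡o%m 3 (3 * p) m (m∣m*n p)

  3p∸1≡2+[p∸1]*3 : ∀ p .{{_ : NonZero p}} → 3 * p ℕ.∸ 1 ≡ 2 + ℕ.pred p * 3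
  3p∸1≡2+[p∸1]*3 p = begin
    3 * p ℕ.∸ 1                      ≡⟨ cong (λ q → 3 * q ℕ.∸ 1) (ℕ.suc-pred p) ⟨
    3 * suc (ℕ.pred p) ℕ.∸ 1         ≡⟨ cong (ℕ._∸ 1) (3[1+q]≡2+q*3+1 (ℕ.pred p)) ⟩
    2 + ℕ.pred p * 3 + 1 ℕ.∸ 1       ≡⟨ ℕ.m+n∸n≡m _ 1 ⟩
    2 + ℕ.pred p * 3                 ∎
    where
    open import Data.Nat.Solver using (module +-*-Solver)
    open +-*-Solver
    3[1+q]≡2+q*3+1 : ∀ q → 3 * suc q ≡ 2 + q * 3 + 1
    3[1+q]≡2+q*3+1 = solve 1 (λ q → con 3 :* (con 1 :+ q) := con 2 :+ q :* con 3 :+ con 1) refl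

  [m+[3p∸1]]%3≡[m%3+2]%3 : ∀ m p .{{_ : NonZero p}} → (m + (3 * p ℕ.∸ 1)) ℕ.% 3 ≡ (m ℕ.% 3 + 2) ℕ.% 3
  [m+[3p∸1]]%3≡[m%3+2]%3 m p = begin
    (m + (3 * p ℕ.∸ 1)) ℕ.% 3        ≡⟨ cong (λ r → (m + r) ℕ.% 3) (3p∸1≡2+[p∸1]*3 p) ⟩
    (m + (2 + ℕ.pred p * 3)) ℕ.% 3   ≡⟨ cong (ℕ._% 3) (ℕ.+-assoc m 2 _) ⟨
    (m + 2 + ℕ.pred p * 3) ℕ.% 3     ≡⟨ [m+kn]%n≡m%n (m + 2) (ℕ.pred p) 3 ⟩
    (m + 2) ℕ.% 3                    ≡⟨ [m%d+n]%d≡[m+n]%d m 2 3 ⟨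
    (m ℕ.% 3 + 2) ℕ.% 3              ∎

module EuclideanDivision where

  private
    <-by-quotient : ∀ d {r r' q q'} → r ℕ.< d → q ℤ.< q' →
                    + r ℤ.+ q ℤ.* + d ℤ.< + r' ℤ.+ q' ℤ.* + d
    <-by-quotient d {r} {r'} {q} {q'} r<d q<q' = ℤ.<-≤-trans
      (ℤ.+-monoˡ-< (q ℤ.* + d) (ℤ.+<+ r<d))
      (ℤ.≤-trans (subst (ℤ._≤ q' ℤ.* + d) (ℤ.suc-* q (+ d))
                        (ℤ.*-monoʳ-≤-nonNeg (+ d) (ℤ.i<j⇒suc[i]≤j q<q')))
                 (ℤ.i≤j+i _ (+ r')))

  divMod-unique : ∀ d {r r' q q'} → r ℕ.< d → r' ℕ.< d →
                  + r ℤ.+ q ℤ.* + d ≡ + r' ℤ.+ q' ℤ.* + d → r ≡ r' × q ≡ q'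
  divMod-unique d {r} {r'} {q} {q'} r<d r'<d eq with ℤ.<-cmp q q'
  ... | tri< q<q' _ _ = ⊥-elim (ℤ.<-irrefl eq (<-by-quotient d r<d q<q'))
  ... | tri> _ _ q>q' = ⊥-elim (ℤ.<-irrefl (sym eq) (<-by-quotient d r'<d q>q'))
  ... | tri≈ _ refl _ = ℤ.+-injective (∙-cancelʳ (q ℤ.* + d) (+ r) (+ r') eq) , refl

  %ℕ-/ℕ-unique : ∀ z d .{{_ : NonZero d}} r q → r ℕ.< d → z ≡ + r ℤ.+ q ℤ.* + d →
                 z %ℕ d ≡ r × z /ℕ d ≡ q
  %ℕ-/ℕ-unique z d r q r<d eq =
    divMod-unique d (n%ℕd<d z d) r<d (trans (sym (a≡a%ℕn+[a/ℕn]*n z d)) eq)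

module _ (M : ℕ) (k : KType) (a : ℕ) .{{_ : NonZero a}} (p : ℕ) .{{_ : NonZero p}} where

  open Setting M k a p
  open EuclideanDivision
  open ℤ-Solver
  open ModularArithmetic

  -- The lattice Λ

  sumOn : Vecℤ → List (Fin n) → ℤ
  sumOn v L = foldr ℤ._+_ (+ 0) (map v L)

  sumOn-cong : ∀ {u v} L → (∀ j → u j ≡ v j) → sumOn u L ≡ sumOn v L
  sumOn-cong []      u≗v = refl
  sumOn-cong (j ∷ L) u≗v = cong₂ ℤ._+_ (u≗v j) (sumOn-cong L u≗v)

  sumOn-⊕ : ∀ u v L → sumOn (u ⊕ v) L ≡ sumOn u L ℤ.+ sumOn v L
  sumOn-⊕ u v []      = refl
  sumOn-⊕ u v (j ∷ L) rewrite sumOn-⊕ u v L =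
    solve 4 (λ x y s t → (x :+ y) :+ (s :+ t) := (x :+ s) :+ (y :+ t)) refl (u j) (v j) (sumOn u L) (sumOn v L)

  sumOn-neg : ∀ v L → sumOn (λ j → ℤ.- v j) L ≡ ℤ.- sumOn v L
  sumOn-neg v []      = refl
  sumOn-neg v (j ∷ L) rewrite sumOn-neg v L = sym (ℤ.neg-distrib-+ (v j) (sumOn v L))

  sumOn-zero : ∀ L → sumOn zeroV L ≡ + 0
  sumOn-zero []      = refl
  sumOn-zero (j ∷ L) = trans (ℤ.+-identityˡ _) (sumOn-zero L)

  -- Λ = a·Λ₀ with Λ₀ the integer points, the even-sum points, or the equal-parity points.
  Λ₀ : KType → Vecℤ → Set
  Λ₀ k1 y = ⊤
  Λ₀ k2 y = ∃ λ s → sumℤ y ≡ s ℤ.* + 2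
  Λ₀ kn y = Σ ℤ λ c → Σ Vecℤ λ q → ∀ j → y j ≡ c ℤ.+ q j ℤ.* + 2

  InΛ : KType → Vecℤ → Set
  InΛ κ v = Σ Vecℤ λ y → (∀ j → v j ≡ y j ℤ.* + a) × Λ₀ κ y

  Λ₀-zero : ∀ κ → Λ₀ κ zeroV
  Λ₀-zero k1 = tt
  Λ₀-zero k2 = + 0 , sumOn-zero (allFin n)
  Λ₀-zero kn = + 0 , zeroV , λ j → refl

  Λ₀-⊕ : ∀ κ {y y'} → Λ₀ κ y → Λ₀ κ y' → Λ₀ κ (y ⊕ y')
  Λ₀-⊕ k1 _ _ = tt
  Λ₀-⊕ k2 {y} {y'} (s , eq) (s' , eq') = s ℤ.+ s' , (begin
    sumℤ (y ⊕ y')            ≡⟨ sumOn-⊕ y y' (allFin n) ⟩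
    sumℤ y ℤ.+ sumℤ y'       ≡⟨ cong₂ ℤ._+_ eq eq' ⟩
    s ℤ.* + 2 ℤ.+ s' ℤ.* + 2 ≡⟨ sym (ℤ.*-distribʳ-+ (+ 2) s s') ⟩
    (s ℤ.+ s') ℤ.* + 2       ∎)
    where open ≡-Reasoning
  Λ₀-⊕ kn (c , q , eq) (c' , q' , eq') = c ℤ.+ c' , q ⊕ q' , λ j →
    trans (cong₂ ℤ._+_ (eq j) (eq' j))
          (solve 4 (λ c c' x x' → (c :+ x :* con (+ 2)) :+ (c' :+ x' :* con (+ 2))
                                  := (c :+ c') :+ (x :+ x') :* con (+ 2)) refl c c' (q j) (q' j))

  Λ₀-neg : ∀ κ {y} → Λ₀ κ y → Λ₀ κ (λ j → ℤ.- y j)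
  Λ₀-neg k1 _ = tt
  Λ₀-neg k2 {y} (s , eq) = ℤ.- s ,
    trans (sumOn-neg y (allFin n)) (trans (cong ℤ.-_ eq) (ℤ.neg-distribˡ-* s (+ 2)))
  Λ₀-neg kn (c , q , eq) = ℤ.- c , (λ j → ℤ.- q j) , λ j →
    trans (cong ℤ.-_ (eq j))
          (solve 2 (λ c x → :- (c :+ x :* con (+ 2)) := (:- c) :+ (:- x) :* con (+ 2)) refl c (q j))

  InΛ-cong : ∀ κ {u v} → (∀ j → u j ≡ v j) → InΛ κ u → InΛ κ v
  InΛ-cong κ u≗v (y , eq , y∈Λ₀) = y , (λ j → trans (sym (u≗v j)) (eq j)) , y∈Λ₀

  InΛ-zero : ∀ κ → InΛ κ zeroV
  InΛ-zero κ = zeroV , (λ j → sym (ℤ.*-zeroˡ (+ a))) , Λ₀-zero κ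

  InΛ-⊕ : ∀ κ {u v} → InΛ κ u → InΛ κ v → InΛ κ (u ⊕ v)
  InΛ-⊕ κ (y , eq , y∈Λ₀) (y' , eq' , y'∈Λ₀) = y ⊕ y' ,
    (λ j → trans (cong₂ ℤ._+_ (eq j) (eq' j)) (sym (ℤ.*-distribʳ-+ (+ a) (y j) (y' j)))) ,
    Λ₀-⊕ κ y∈Λ₀ y'∈Λ₀

  InΛ-neg : ∀ κ {v} → InΛ κ v → InΛ κ (λ j → ℤ.- v j)
  InΛ-neg κ (y , eq , y∈Λ₀) = (λ j → ℤ.- y j) ,
    (λ j → trans (cong ℤ.-_ (eq j)) (ℤ.neg-distribˡ-* (y j) (+ a))) , Λ₀-neg κ y∈Λ₀

  private
    *-quotient : ∀ z y (d : ℕ) .{{_ : NonZero d}} → z ≡ y ℤ.* + d → z %ℕ d ≡ 0 × z /ℕ d ≡ y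
    *-quotient z y d eq = %ℕ-/ℕ-unique z d 0 y (ℕ.>-nonZero⁻¹ d) (trans eq (sym (ℤ.+-identityˡ _)))

    %ℕ≡0⇒≡/ℕ* : ∀ z (d : ℕ) .{{_ : NonZero d}} → z %ℕ d ≡ 0 → z ≡ (z /ℕ d) ℤ.* + d
    %ℕ≡0⇒≡/ℕ* z d z%d≡0 = trans (a≡a%ℕn+[a/ℕn]*n z d)
      (trans (cong (λ r → + r ℤ.+ (z /ℕ d) ℤ.* + d) z%d≡0) (ℤ.+-identityˡ _))

  -- inΛ only computes once the lattice type is a constructor, so membership is decoded
  -- for an arbitrary type κ rather than for the parameter k.
  private module Lattice (κ : KType) = Setting M κ a p

  private
    divisibleAt : Vecℤ → Fin n → Bool
    divisibleAt v j = (v j %ℕ a) == 0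

    divisible : ∀ κ v → T (Lattice.inΛ κ v) → ∀ j → v j %ℕ a ≡ 0
    divisible κ v v∈Λ j = ℕ.≡ᵇ⇒≡ _ 0
      (T-foldr-∧ (divisibleAt v) (allFin n) (proj₁ (T-∧-elim {Lattice.allB κ (divisibleAt v)} v∈Λ)) (∈-allFin j))

  inΛ⇒InΛ : ∀ κ v → T (Lattice.inΛ κ v) → InΛ κ v
  inΛ⇒InΛ κ v v∈Λ = y , (λ j → %ℕ≡0⇒≡/ℕ* (v j) a (divisible κ v v∈Λ j)) , y∈Λ₀ κ v∈Λ
    where
    y : Vecℤ
    y j = v j /ℕ a
    y∈Λ₀ : ∀ κ → T (Lattice.inΛ κ v) → Λ₀ κ y
    y∈Λ₀ k1 _ = tt
    y∈Λ₀ k2 v∈Λ = sumℤ y /ℕ 2 ,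
      %ℕ≡0⇒≡/ℕ* (sumℤ y) 2 (ℕ.≡ᵇ⇒≡ _ 0 (proj₂ (T-∧-elim {Lattice.allB k2 (divisibleAt v)} v∈Λ)))
    y∈Λ₀ kn v∈Λ = + (y Fin.zero %ℕ 2) , (λ j → y j /ℕ 2) , λ j →
      trans (a≡a%ℕn+[a/ℕn]*n (y j) 2) (cong (λ r → + r ℤ.+ (y j /ℕ 2) ℤ.* + 2) (sameParity j))
      where
      sameParity : ∀ j → y j %ℕ 2 ≡ y Fin.zero %ℕ 2
      sameParity j = ℕ.≡ᵇ⇒≡ _ _ (T-foldr-∧ (λ j → Lattice.parity kn (y j) == Lattice.parity kn (y Fin.zero)) (allFin n)
                                 (proj₂ (T-∧-elim {Lattice.allB kn (divisibleAt v)} v∈Λ)) (∈-allFin j))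

  private
    parity-unique : ∀ (c q z : ℤ) → z ≡ c ℤ.+ q ℤ.* + 2 → z %ℕ 2 ≡ c %ℕ 2
    parity-unique c q z eq = proj₁ (%ℕ-/ℕ-unique z 2 (c %ℕ 2) (c /ℕ 2 ℤ.+ q) (n%ℕd<d c 2) (begin
      z                                              ≡⟨ eq ⟩
      c ℤ.+ q ℤ.* + 2                                ≡⟨ cong (λ c → c ℤ.+ q ℤ.* + 2) (a≡a%ℕn+[a/ℕn]*n c 2) ⟩
      + (c %ℕ 2) ℤ.+ (c /ℕ 2) ℤ.* + 2 ℤ.+ q ℤ.* + 2  ≡⟨ solve 3 (λ r s q → r :+ s :* con (+ 2) :+ q :* con (+ 2)
                                                          := r :+ (s :+ q) :* con (+ 2)) refl (+ (c %ℕ 2)) (c /ℕ 2) q ⟩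
      + (c %ℕ 2) ℤ.+ (c /ℕ 2 ℤ.+ q) ℤ.* + 2          ∎))
      where open ≡-Reasoning

    allDivisible : ∀ κ (v y : Vecℤ) → (∀ j → v j ≡ y j ℤ.* + a) → T (Lattice.allB κ (divisibleAt v))
    allDivisible κ v y eq = foldr-∧-T (divisibleAt v) (allFin n)
      (λ j → ℕ.≡⇒≡ᵇ (v j %ℕ a) 0 (proj₁ (*-quotient (v j) (y j) a (eq j))))

    quotient≗ : ∀ (v y : Vecℤ) → (∀ j → v j ≡ y j ℤ.* + a) → ∀ j → v j /ℕ a ≡ y j
    quotient≗ v y eq j = proj₂ (*-quotient (v j) (y j) a (eq j))

  InΛ⇒inΛ : ∀ κ v → InΛ κ v → T (Lattice.inΛ κ v)
  InΛ⇒inΛ k1 v (y , eq , _) = T-∧-intro {Lattice.allB k1 (divisibleAt v)} (allDivisible k1 v y eq) tt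
  InΛ⇒inΛ k2 v (y , eq , s , sum≡) = T-∧-intro {Lattice.allB k2 (divisibleAt v)} (allDivisible k2 v y eq)
    (ℕ.≡⇒≡ᵇ _ 0 (proj₁ (*-quotient _ s 2 (trans (sumOn-cong (allFin n) (quotient≗ v y eq)) sum≡))))
  InΛ⇒inΛ kn v (y , eq , c , q , y≡) = T-∧-intro {Lattice.allB kn (divisibleAt v)} (allDivisible kn v y eq)
    (foldr-∧-T _ (allFin n) (λ j → ℕ.≡⇒≡ᵇ _ _ (trans (parity≡ j) (sym (parity≡ Fin.zero)))))
    where
    parity≡ : ∀ j → (v j /ℕ a) %ℕ 2 ≡ c %ℕ 2
    parity≡ j = parity-unique c (q j) _ (trans (quotient≗ v y eq j) (y≡ j))

  ≈Λ-refl : ∀ u → u ≈Λ u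
  ≈Λ-refl u = InΛ⇒inΛ k (u ⊖ u) (InΛ-cong k (λ j → sym (ℤ.+-inverseʳ (u j))) (InΛ-zero k))

  ≈Λ-sym : ∀ u v → u ≈Λ v → v ≈Λ u
  ≈Λ-sym u v u≈v = InΛ⇒inΛ k (v ⊖ u)
    (InΛ-cong k (λ j → solve 2 (λ x y → :- (x :- y) := y :- x) refl (u j) (v j))
                (InΛ-neg k (inΛ⇒InΛ k (u ⊖ v) u≈v)))

  ≈Λ-trans : ∀ u v w → u ≈Λ v → v ≈Λ w → u ≈Λ w
  ≈Λ-trans u v w u≈v v≈w = InΛ⇒inΛ k (u ⊖ w)
    (InΛ-cong k (λ j → solve 3 (λ x y z → (x :- y) :+ (y :- z) := x :- z) refl (u j) (v j) (w j))
                (InΛ-⊕ k (inΛ⇒InΛ k (u ⊖ v) u≈v) (inΛ⇒InΛ k (v ⊖ w) v≈w)))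

  small-coordinate⇒∉Λ : ∀ v j m → v j ≡ + m → 0 ℕ.< m → m ℕ.< a → ¬ T (inΛ v)
  small-coordinate⇒∉Λ v j m vj≡m 0<m m<a v∈Λ with inΛ⇒InΛ k v v∈Λ
  ... | y , eq , _ = ℕ.<-irrefl (trans (sym m%a≡0) m%a≡m) 0<m
    where
    m%a≡0 : + m %ℕ a ≡ 0
    m%a≡0 = proj₁ (*-quotient (+ m) (y j) a (trans (sym vj≡m) (eq j)))
    m%a≡m : + m %ℕ a ≡ m
    m%a≡m = proj₁ (%ℕ-/ℕ-unique (+ m) a m (+ 0) m<a (sym (ℤ.+-identityʳ (+ m))))

  ≈Λ?-resp : ∀ F G H → F ≈Λ G → (F ≈Λ? H) ≡ (G ≈Λ? H)
  ≈Λ?-resp F G H F≈G = T-extensional (≈Λ-trans G F H (≈Λ-sym F G F≈G)) (≈Λ-trans F G H F≈G)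

  T-anyL : ∀ {A : Set} (f : A → Bool) L → T (anyL f L) → Any (T ∘ f) L
  T-anyL f (z ∷ L) fz∨ with to (T-∨ {f z}) fz∨
  ... | inj₁ fz = here fz
  ... | inj₂ fL = there (T-anyL f L fL)

  anyL-T : ∀ {A : Set} (f : A → Bool) L → Any (T ∘ f) L → T (anyL f L)
  anyL-T f (z ∷ L) (here fz)  = from (T-∨ {f z}) (inj₁ fz)
  anyL-T f (z ∷ L) (there fL) = from (T-∨ {f z}) (inj₂ (anyL-T f L fL))

  incXH?-resp : ∀ F G → F ≈Λ G → incXH? F ≡ incXH? G
  incXH?-resp F G F≈G = T-extensional (transport F G F≈G) (transport G F (≈Λ-sym F G F≈G))
    where
    transport : ∀ F G → F ≈Λ G → T (incXH? F) → T (incXH? G)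
    transport F G F≈G F∈X = anyL-T _ (epsilons n)
      (Any.map (λ {ε} → ≈Λ-trans G F (cH ⊕ ε) (≈Λ-sym F G F≈G)) (T-anyL _ (epsilons n) F∈X))

  inH?-resp : ∀ F G ℓ → F ≈Λ G → inH? F ℓ ≡ inH? G ℓ
  inH?-resp F G ℓ F≈G = cong (_∧ (ℓ == 1)) (incXH?-resp F G F≈G)

  -- Flags and monodromy

  ≈F-refl : ∀ Φ → Φ ≈F Φ
  ≈F-refl Φ = (λ _ → refl) , (λ _ → refl) , ≈Λ-refl (t Φ)

  ≈F-sym : ∀ Φ Ψ → Φ ≈F Ψ → Ψ ≈F Φ
  ≈F-sym Φ Ψ (σ≗ , x≗ , t≈) = (λ j → sym (σ≗ j)) , (λ j → sym (x≗ j)) , ≈Λ-sym (t Φ) (t Ψ) t≈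

  ≈F-trans : ∀ Φ Ψ Θ → Φ ≈F Ψ → Ψ ≈F Θ → Φ ≈F Θ
  ≈F-trans Φ Ψ Θ (σ≗ , x≗ , t≈) (σ≗' , x≗' , t≈') =
    (λ j → trans (σ≗ j) (σ≗' j)) , (λ j → trans (x≗ j) (x≗' j)) , ≈Λ-trans (t Φ) (t Ψ) (t Θ) t≈ t≈'

  flagSetoid : Setoid 0ℓ 0ℓ
  flagSetoid = record
    { Carrier       = Flag
    ; _≈_           = _≈F_
    ; isEquivalence = record
      { refl  = λ {Φ} → ≈F-refl Φ
      ; sym   = λ {Φ} {Ψ} → ≈F-sym Φ Ψ
      ; trans = λ {Φ} {Ψ} {Θ} → ≈F-trans Φ Ψ Θ
      }
    }

  module FlagReasoning = SetoidReasoning flagSetoid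

  negAt-self : ∀ i s → negAt i s i ≡ Sign.opposite (s i)
  negAt-self i s with i Fin.≟ i
  ... | yes _  = refl
  ... | no i≢i = ⊥-elim (i≢i refl)

  negAt-other : ∀ i s {j} → j ≢ i → negAt i s j ≡ s j
  negAt-other i s {j} j≢i with j Fin.≟ i
  ... | yes j≡i = ⊥-elim (j≢i j≡i)
  ... | no _    = refl

  negAt-involutive : ∀ i s j → negAt i (negAt i s) j ≡ s j
  negAt-involutive i s j with j Fin.≟ i
  ... | yes _ = Sign.opposite-involutive (s j)
  ... | no _  = refl

  facet-r : ∀ m Φ → t (r m Φ) ≡ t Φ
  facet-r Fin.zero    Φ = refl
  facet-r (Fin.suc i) Φ = refl

  r-cong : ∀ m Φ Ψ → Φ ≈F Ψ → r m Φ ≈F r m Ψ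
  r-cong Fin.zero    Φ Ψ (σ≗ , x≗ , t≈) = σ≗ , negAt≗ , t≈
    where
    negAt≗ : ∀ j → negAt (σ Φ ⟨$⟩ʳ Fin.zero) (x Φ) j ≡ negAt (σ Ψ ⟨$⟩ʳ Fin.zero) (x Ψ) j
    negAt≗ j rewrite σ≗ Fin.zero | x≗ j = refl
  r-cong (Fin.suc i) Φ Ψ (σ≗ , x≗ , t≈) = (λ j → σ≗ (PC.transpose (Fin.inject₁ i) (Fin.suc i) j)) , x≗ , t≈

  r-involutive : ∀ m Φ → r m (r m Φ) ≈F Φ
  r-involutive Fin.zero    Φ = (λ _ → refl) , negAt-involutive _ (x Φ) , ≈Λ-refl (t Φ)
  r-involutive (Fin.suc i) Φ =
    (λ j → cong (σ Φ ⟨$⟩ʳ_) (transpose-involutive j)) , (λ _ → refl) , ≈Λ-refl (t Φ)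
    where open Transposition (Fin.inject₁ i) (Fin.suc i)

  r-transpose : ∀ m Φ Ψ → r m Φ ≈F Ψ → Φ ≈F r m Ψ
  r-transpose m Φ Ψ rΦ≈Ψ = begin
    Φ           ≈⟨ ≈F-sym (r m (r m Φ)) Φ (r-involutive m Φ) ⟩
    r m (r m Φ) ≈⟨ r-cong m (r m Φ) Ψ rΦ≈Ψ ⟩
    r m Ψ       ∎
    where open FlagReasoning

  r-injective : ∀ m Φ Ψ → r m Φ ≈F r m Ψ → Φ ≈F Ψ
  r-injective m Φ Ψ rΦ≈rΨ = ≈F-trans Φ (r m (r m Ψ)) Ψ (r-transpose m Φ (r m Ψ) rΦ≈rΨ) (r-involutive m Ψ)

  Word : Set
  Word = List (Fin n)

  act : Word → Flag → Flag
  act w Φ = foldr r Φ w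

  act-facet : ∀ w Φ → t (act w Φ) ≡ t Φ
  act-facet []      Φ = refl
  act-facet (m ∷ w) Φ = trans (facet-r m (act w Φ)) (act-facet w Φ)

  act-cong : ∀ w Φ Ψ → Φ ≈F Ψ → act w Φ ≈F act w Ψ
  act-cong []      Φ Ψ Φ≈Ψ = Φ≈Ψ
  act-cong (m ∷ w) Φ Ψ Φ≈Ψ = r-cong m (act w Φ) (act w Ψ) (act-cong w Φ Ψ Φ≈Ψ)

  Reachable : Flag → Flag → Set
  Reachable R Ψ = ∃ λ w → act w R ≈F Ψ

  reachable-refl : ∀ R → Reachable R R
  reachable-refl R = [] , ≈F-refl R

  reachable-step : ∀ {R} m Ψ → Reachable R Ψ → Reachable R (r m Ψ)
  reachable-step {R} m Ψ (w , wR≈Ψ) = m ∷ w , r-cong m (act w R) Ψ wR≈Ψ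

  reachable-resp : ∀ {R} Ψ Ψ' → Ψ ≈F Ψ' → Reachable R Ψ → Reachable R Ψ'
  reachable-resp {R} Ψ Ψ' Ψ≈Ψ' (w , wR≈Ψ) = w , ≈F-trans (act w R) Ψ Ψ' wR≈Ψ Ψ≈Ψ'

  AgreeBelow : ℕ → Permutation′ n → Permutation′ n → Set
  AgreeBelow m π π' = ∀ j → toℕ j ℕ.< m → π ⟨$⟩ʳ j ≡ π' ⟨$⟩ʳ j

  -- Adjacent transpositions carry the entry at position q down to position K ≤ q,
  -- leaving the positions below K untouched.
  bubble-down : ∀ {R} y u d π K q → toℕ q ≡ toℕ K ℕ.+ d → Reachable R (flag π y u) →
                ∃ λ π' → Reachable R (flag π' y u) × π' ⟨$⟩ʳ K ≡ π ⟨$⟩ʳ q × AgreeBelow (toℕ K) π' π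
  bubble-down y u zero π K q q≡K+0 reach =
    π , reach , cong (π ⟨$⟩ʳ_) (sym (Fin.toℕ-injective (trans q≡K+0 (ℕ.+-identityʳ _)))) , λ _ _ → refl
  bubble-down y u (suc d) π K Fin.zero q≡K+d _ = ⊥-elim (ℕ.0≢1+n (trans q≡K+d (ℕ.+-suc (toℕ K) d)))
  bubble-down {R} y u (suc d) π K (Fin.suc i) q≡K+d reach
    with bubble-down y u d (transpose (Fin.inject₁ i) (Fin.suc i) ∘ₚ π) K (Fin.inject₁ i) i≡K+d
                     (reachable-step (Fin.suc i) (flag π y u) reach)
    where
    i≡K+d : toℕ (Fin.inject₁ i) ≡ toℕ K ℕ.+ d
    i≡K+d = trans (Fin.toℕ-inject₁ i) (ℕ.suc-injective (trans q≡K+d (ℕ.+-suc (toℕ K) d)))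
  ... | π' , reach' , π'K , agree =
    π' , reach' , trans π'K (cong (π ⟨$⟩ʳ_) transpose-left) ,
    λ j j<K → trans (agree j j<K) (cong (π ⟨$⟩ʳ_) (transpose-other (≢inject₁ (j<i j<K)) (≢suc (j<i j<K))))
    where
    open Transposition (Fin.inject₁ i) (Fin.suc i)
    j<i : ∀ {j} → toℕ j ℕ.< toℕ K → toℕ j ℕ.< toℕ i
    j<i j<K = ℕ.<-≤-trans j<K (ℕ.≤-trans (ℕ.m≤m+n (toℕ K) d)
                (ℕ.≤-reflexive (sym (ℕ.suc-injective (trans q≡K+d (ℕ.+-suc (toℕ K) d))))))
    ≢inject₁ : ∀ {j} → toℕ j ℕ.< toℕ i → j ≢ Fin.inject₁ i
    ≢inject₁ j<i refl = ℕ.<-irrefl (Fin.toℕ-inject₁ i) j<i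
    ≢suc : ∀ {j} → toℕ j ℕ.< toℕ i → j ≢ Fin.suc i
    ≢suc j<i refl = ℕ.<-irrefl refl (ℕ.<-trans (ℕ.n<1+n _) j<i)

  preimage-not-below : ∀ (π σ' : Permutation′ n) K → AgreeBelow (toℕ K) π σ' →
                       toℕ K ℕ.≤ toℕ (π ⟨$⟩ˡ (σ' ⟨$⟩ʳ K))
  preimage-not-below π σ' K agree = ℕ.≮⇒≥ λ q<K →
    ℕ.<-irrefl (cong toℕ (⟨$⟩ʳ-injective σ' (trans (sym (agree _ q<K)) (Perm.inverseʳ π)))) q<K

  extend-agreement : ∀ {R} y u σ' K π → AgreeBelow (toℕ K) π σ' → Reachable R (flag π y u) →
                     ∃ λ π' → Reachable R (flag π' y u) × AgreeBelow (suc (toℕ K)) π' σ'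
  extend-agreement y u σ' K π agree reach
    with bubble-down y u (toℕ q ℕ.∸ toℕ K) π K q (sym (ℕ.m+[n∸m]≡n (preimage-not-below π σ' K agree))) reach
    where
    q : Fin n
    q = π ⟨$⟩ˡ (σ' ⟨$⟩ʳ K)
  ... | π' , reach' , π'K , agree' = π' , reach' , agree''
    where
    agree'' : AgreeBelow (suc (toℕ K)) π' σ'
    agree'' j j<1+K with ℕ.m<1+n⇒m<n∨m≡n j<1+K
    ... | inj₁ j<K = trans (agree' j j<K) (agree j j<K)
    ... | inj₂ j≡K with Fin.toℕ-injective j≡K
    ...   | refl = trans π'K (Perm.inverseʳ π)

  align-prefix : ∀ {R} y u σ' m → m ℕ.≤ n → ∀ π → Reachable R (flag π y u) →
                 ∃ λ π' → Reachable R (flag π' y u) × AgreeBelow m π' σ'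
  align-prefix y u σ' zero    _   π reach = π , reach , λ _ ()
  align-prefix y u σ' (suc m) m<n π reach with align-prefix y u σ' m (ℕ.<⇒≤ m<n) π reach
  ... | π₁ , reach₁ , agree₁ = subst (λ l → ∃ λ π' → Reachable _ (flag π' y u) × AgreeBelow (suc l) π' σ') K≡m
          (extend-agreement y u σ' K π₁ (subst (λ l → AgreeBelow l π₁ σ') (sym K≡m) agree₁) reach₁)
    where
    K : Fin n
    K = Fin.fromℕ< m<n
    K≡m : toℕ K ≡ m
    K≡m = Fin.toℕ-fromℕ< m<n

  reach-any-permutation : ∀ {R} y u π σ' → Reachable R (flag π y u) → Reachable R (flag σ' y u)
  reach-any-permutation {R} y u π σ' reach = aligned (align-prefix y u σ' n ℕ.≤-refl π reach)
    where
    aligned : (∃ λ π' → Reachable R (flag π' y u) × AgreeBelow n π' σ') → Reachable R (flag σ' y u)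
    aligned (π' , reach' , agree) =
      reachable-resp (flag π' y u) (flag σ' y u) ((λ j → agree j (Fin.toℕ<n j)) , (λ _ → refl) , ≈Λ-refl u) reach'

  reach-negAt : ∀ {R} y u → (∀ π → Reachable R (flag π y u)) → ∀ v π → Reachable R (flag π (negAt v y) u)
  reach-negAt y u reach v π = reach-any-permutation (negAt v y) u τ π
    (reachable-resp (r₀ (flag τ y u)) (flag τ (negAt v y) u)
                    ((λ _ → refl) , negAt≗ , ≈Λ-refl u) (reachable-step Fin.zero (flag τ y u) (reach τ)))
    where
    τ : Permutation′ n
    τ = transpose Fin.zero v
    negAt≗ : ∀ j → negAt (τ ⟨$⟩ʳ Fin.zero) y j ≡ negAt v y j
    negAt≗ j rewrite Transposition.transpose-left Fin.zero v = refl

  above-K : ∀ {m j} (m<n : m ℕ.< n) → m ℕ.≤ toℕ j → j ≢ Fin.fromℕ< m<n → suc m ℕ.≤ toℕ j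
  above-K m<n m≤j j≢K with ℕ.m≤n⇒m<n∨m≡n m≤j
  ... | inj₁ m<j = m<j
  ... | inj₂ m≡j = ⊥-elim (j≢K (Fin.toℕ-injective (trans (sym m≡j) (sym (Fin.toℕ-fromℕ< m<n)))))

  SignsReachableAbove : Flag → ℕ → Set
  SignsReachableAbove R m = ∀ y → (∀ j → m ℕ.≤ toℕ j → y j ≡ x R j) → ∀ π → Reachable R (flag π y (t R))

  signs-reachable : ∀ R m → m ℕ.≤ n → SignsReachableAbove R m
  signs-reachable R zero _ y y≗ π = reach-any-permutation y (t R) (σ R) π
    (reachable-resp R (flag (σ R) y (t R)) ((λ _ → refl) , (λ j → sym (y≗ j z≤n)) , ≈Λ-refl (t R)) (reachable-refl R))
  signs-reachable R (suc m) m<n y y≗ π with y K Sign.≟ x R K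
    where
    K : Fin n
    K = Fin.fromℕ< m<n
  ... | yes yK≡ = signs-reachable R m (ℕ.<⇒≤ m<n) y agree π
    where
    agree : ∀ j → m ℕ.≤ toℕ j → y j ≡ x R j
    agree j m≤j with j Fin.≟ Fin.fromℕ< m<n
    ... | yes refl = yK≡
    ... | no j≢K = y≗ j (above-K m<n m≤j j≢K)
  ... | no yK≢ = reachable-resp (flag π (negAt K (negAt K y)) (t R)) (flag π y (t R))
                   ((λ _ → refl) , negAt-involutive K y , ≈Λ-refl (t R))
                   (reach-negAt (negAt K y) (t R) (signs-reachable R m (ℕ.<⇒≤ m<n) (negAt K y) agree) K π)
    where
    K : Fin n
    K = Fin.fromℕ< m<n
    agree : ∀ j → m ℕ.≤ toℕ j → negAt K y j ≡ x R j
    agree j m≤j = by-cases (j Fin.≟ K)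
      where
      by-cases : Dec (j ≡ K) → negAt K y j ≡ x R j
      by-cases (yes j≡K) = subst (λ l → negAt K y l ≡ x R l) (sym j≡K) (trans (negAt-self K y) (opposite-≢ yK≢))
      by-cases (no j≢K)  = trans (negAt-other K y j≢K) (y≗ j (above-K m<n m≤j j≢K))

  reach-same-facet : ∀ R Ψ → t Ψ ≈Λ t R → Reachable R Ψ
  reach-same-facet R Ψ Ψ≈R =
    reachable-resp (flag (σ Ψ) (x Ψ) (t R)) Ψ ((λ _ → refl) , (λ _ → refl) , ≈Λ-sym (t Ψ) (t R) Ψ≈R)
      (signs-reachable R n ℕ.≤-refl (x Ψ) (λ j n≤j → ⊥-elim (ℕ.<⇒≱ (Fin.toℕ<n j) n≤j)) (σ Ψ))

  record Equivariant (F : Facet) (f : Flag → Flag) : Set where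
    field
      respects : ∀ Ψ Ψ' → facet Ψ ≈Λ F → Ψ ≈F Ψ' → f Ψ ≈F f Ψ'
      commutes : ∀ Ψ → facet Ψ ≈Λ F → ∀ m → f (r m Ψ) ≈F r m (f Ψ)

  id-equivariant : ∀ F → Equivariant F (λ Ψ → Ψ)
  id-equivariant F = record { respects = λ _ _ _ Ψ≈Ψ' → Ψ≈Ψ' ; commutes = λ Ψ _ m → ≈F-refl (r m Ψ) }

  equivariant-act : ∀ {F f} → Equivariant F f → ∀ w Ψ → facet Ψ ≈Λ F → f (act w Ψ) ≈F act w (f Ψ)
  equivariant-act {F} {f} f-eq []      Ψ Ψ∈F = ≈F-refl (f Ψ)
  equivariant-act {F} {f} f-eq (m ∷ w) Ψ Ψ∈F = begin
    f (r m (act w Ψ)) ≈⟨ Equivariant.commutes f-eq (act w Ψ) (subst (_≈Λ F) (sym (act-facet w Ψ)) Ψ∈F) m ⟩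
    r m (f (act w Ψ)) ≈⟨ r-cong m (f (act w Ψ)) (act w (f Ψ)) (equivariant-act f-eq w Ψ Ψ∈F) ⟩
    r m (act w (f Ψ)) ∎
    where open FlagReasoning

  -- The monodromy group acts transitively on the flags of a facet.
  equivariant-unique : ∀ F f g → Equivariant F f → Equivariant F g →
                       ∀ R → facet R ≈Λ F → f R ≈F g R → ∀ Ψ → facet Ψ ≈Λ F → f Ψ ≈F g Ψ
  equivariant-unique F f g f-eq g-eq R R∈F fR≈gR Ψ Ψ∈F =
    along (reach-same-facet R Ψ (≈Λ-trans (t Ψ) F (t R) Ψ∈F (≈Λ-sym (t R) F R∈F)))
    where
    open FlagReasoning
    along : Reachable R Ψ → f Ψ ≈F g Ψ
    along (w , wR≈Ψ) = begin
      f Ψ         ≈⟨ Equivariant.respects f-eq Ψ (act w R) Ψ∈F (≈F-sym (act w R) Ψ wR≈Ψ) ⟩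
      f (act w R) ≈⟨ equivariant-act f-eq w R R∈F ⟩
      act w (f R) ≈⟨ act-cong w (f R) (g R) fR≈gR ⟩
      act w (g R) ≈⟨ equivariant-act g-eq w R R∈F ⟨
      g (act w R) ≈⟨ Equivariant.respects g-eq (act w R) Ψ (subst (_≈Λ F) (sym (act-facet w R)) R∈F) wR≈Ψ ⟩
      g Ψ         ∎

  -- The maps ρ

  equivariant-∘ : ∀ F f g → Equivariant F f → (∀ Ψ → facet Ψ ≈Λ F → facet (f Ψ) ≈Λ F) →
                  Equivariant F g → Equivariant F (λ Ψ → g (f Ψ))
  equivariant-∘ F f g f-eq f-preserves g-eq = record
    { respects = λ Ψ Ψ' Ψ∈F Ψ≈Ψ' → G.respects (f Ψ) (f Ψ') (f-preserves Ψ Ψ∈F) (F.respects Ψ Ψ' Ψ∈F Ψ≈Ψ')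
    ; commutes = λ Ψ Ψ∈F m → begin
        g (f (r m Ψ)) ≈⟨ G.respects (f (r m Ψ)) (r m (f Ψ)) (f-preserves (r m Ψ) (subst (_≈Λ F) (sym (facet-r m Ψ)) Ψ∈F))
                                    (F.commutes Ψ Ψ∈F m) ⟩
        g (r m (f Ψ)) ≈⟨ G.commutes (f Ψ) (f-preserves Ψ Ψ∈F) m ⟩
        r m (g (f Ψ)) ∎
    }
    where
    open FlagReasoning
    module F = Equivariant f-eq
    module G = Equivariant g-eq

  equivariant-involutive : ∀ F f → Equivariant F f → (∀ Ψ → facet Ψ ≈Λ F → facet (f Ψ) ≈Λ F) →
                           ∀ R m → facet R ≈Λ F → f R ≈F r m R → ∀ Ψ → facet Ψ ≈Λ F → f (f Ψ) ≈F Ψ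
  equivariant-involutive F f f-eq f-preserves R m R∈F fR≈rR =
    equivariant-unique F (λ Ψ → f (f Ψ)) (λ Ψ → Ψ) (equivariant-∘ F f f f-eq f-preserves f-eq) (id-equivariant F)
      R R∈F (begin
        f (f R)     ≈⟨ Equivariant.respects f-eq (f R) (r m R) (f-preserves R R∈F) fR≈rR ⟩
        f (r m R)   ≈⟨ Equivariant.commutes f-eq R R∈F m ⟩
        r m (f R)   ≈⟨ r-cong m (f R) (r m R) fR≈rR ⟩
        r m (r m R) ≈⟨ r-involutive m R ⟩
        R           ∎)
    where open FlagReasoning

  choice : Bool → Fin 2
  choice true  = Fin.suc Fin.zero
  choice false = Fin.zero

  ρ^-≡ : ∀ ρ ℓ Y → ρ^ ρ ℓ Y ≡ ρ (choice (inH? (facet Y) ℓ)) (facet Y) ℓ Y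
  ρ^-≡ ρ ℓ Y with inH? (facet Y) ℓ
  ... | true  = refl
  ... | false = refl

  module Reflections (root : Facet → ℕ → Flag) (root-spec : RootSpec root)
                     (ρ : Fin 2 → Facet → ℕ → Flag → Flag) (ρ-spec : RhoSpec root ρ) where

    root-facet : ∀ F ℓ → ℓ ℕ.< m₃ₚ → facet (root F ℓ) ≈Λ F
    root-facet F ℓ ℓ<3p with root-spec F ℓ ℓ<3p
    ... | rule1 , rule2 , rule3 , rule4 , _ = decidable-stable (T? _) by-rules
      where
      R = root F ℓ
      ¬rule1 : ¬ facet R ≈Λ F → ¬ Rule1 F
      ¬rule1 R≉F (i , i∈I₇ , F≈Fᵢ) =
        R≉F (≈Λ-trans (t R) (F_ i) F (proj₂ (proj₂ (rule1 i i∈I₇ F≈Fᵢ))) (≈Λ-sym F (F_ i) F≈Fᵢ))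
      ¬rule2 : ¬ facet R ≈Λ F → ¬ Rule2 F ℓ
      ¬rule2 R≉F r2 with rule2 (¬rule1 R≉F) r2
      ... | Φ , j , (_ , _ , _ , hΦ∈F) , R≈hΦ = R≉F (≈Λ-trans (t R) (t (hbar^ j Φ)) F (proj₂ (proj₂ R≈hΦ)) hΦ∈F)
      by-rules : ¬ ¬ facet R ≈Λ F
      by-rules R≉F with T? (inH? F ℓ)
      ... | yes inH = R≉F (proj₁ (proj₂ (rule3 (¬rule1 R≉F) (¬rule2 R≉F) inH)))
      ... | no ¬inH = R≉F (proj₂ (proj₂ (rule4 (¬rule1 R≉F) (¬rule2 R≉F) ¬inH)))

    index : Fin 2 → Fin n
    index Fin.zero            = Fin.zero
    index (Fin.suc Fin.zero)  = Fin.suc Fin.zero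

    module Rho (i : Fin 2) (F : Facet) (ℓ : ℕ) (ℓ<3p : ℓ ℕ.< m₃ₚ) where

      preserves : ∀ Ψ → facet Ψ ≈Λ F → facet (ρ i F ℓ Ψ) ≈Λ F
      preserves = proj₁ (ρ-spec i F ℓ ℓ<3p)

      equivariant : Equivariant F (ρ i F ℓ)
      equivariant = record
        { respects = proj₁ (proj₂ (proj₂ (proj₂ (ρ-spec i F ℓ ℓ<3p))))
        ; commutes = proj₁ (proj₂ (ρ-spec i F ℓ ℓ<3p))
        }

      at-root : ρ i F ℓ (root F ℓ) ≈F r (index i) (root F ℓ)
      at-root = r₀₁-is-r i (proj₁ (proj₂ (proj₂ (ρ-spec i F ℓ ℓ<3p))))
        where
        r₀₁-is-r : ∀ i → ρ i F ℓ (root F ℓ) ≈F r₀₁ i (root F ℓ) → ρ i F ℓ (root F ℓ) ≈F r (index i) (root F ℓ)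
        r₀₁-is-r Fin.zero           ρR≈rR = ρR≈rR
        r₀₁-is-r (Fin.suc Fin.zero) ρR≈rR = ρR≈rR

      facet-independent : ∀ F' Ψ → F ≈Λ F' → facet Ψ ≈Λ F → ρ i F ℓ Ψ ≈F ρ i F' ℓ Ψ
      facet-independent = proj₂ (proj₂ (proj₂ (proj₂ (ρ-spec i F ℓ ℓ<3p))))

      involutive : ∀ Ψ → facet Ψ ≈Λ F → ρ i F ℓ (ρ i F ℓ Ψ) ≈F Ψ
      involutive = equivariant-involutive F (ρ i F ℓ) equivariant preserves
                     (root F ℓ) (index i) (root-facet F ℓ ℓ<3p) at-root

    -- By rule (1) the root flag of a facet F ≈ F_i is Φ_i, whatever ℓ is.
    ρ-level-independent : ∀ j {i F} → i ∈ I₇ → F ≈Λ F_ i → ∀ {ℓ ℓ'} → ℓ ℕ.< m₃ₚ → ℓ' ℕ.< m₃ₚ →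
                          ∀ Ψ → facet Ψ ≈Λ F → ρ j F ℓ' Ψ ≈F ρ j F ℓ Ψ
    ρ-level-independent j {i} {F} i∈I₇ F≈Fᵢ {ℓ} {ℓ'} ℓ<3p ℓ'<3p =
      equivariant-unique F (ρ j F ℓ') (ρ j F ℓ) ρ'.equivariant ρ.equivariant R (root-facet F ℓ ℓ<3p) (begin
        ρ j F ℓ' R       ≈⟨ Equivariant.respects ρ'.equivariant R R' (root-facet F ℓ ℓ<3p) R≈R' ⟩
        ρ j F ℓ' R'      ≈⟨ ρ'.at-root ⟩
        r (index j) R'   ≈⟨ r-cong (index j) R' R (≈F-sym R R' R≈R') ⟩
        r (index j) R    ≈⟨ ρ.at-root ⟨
        ρ j F ℓ R        ∎)
      where
      open FlagReasoning
      module ρ  = Rho j F ℓ ℓ<3p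
      module ρ' = Rho j F ℓ' ℓ'<3p
      R R' : Flag
      R  = root F ℓ
      R' = root F ℓ'
      R≈R' : R ≈F R'
      R≈R' = ≈F-trans R (Φ_ i) R' (proj₁ (root-spec F ℓ ℓ<3p) i i∈I₇ F≈Fᵢ)
                                  (≈F-sym R' (Φ_ i) (proj₁ (root-spec F ℓ' ℓ'<3p) i i∈I₇ F≈Fᵢ))

    ρ^-unfold : ∀ ℓ → ℓ ℕ.< m₃ₚ → ∀ F Y → facet Y ≈Λ F → ρ^ ρ ℓ Y ≈F ρ (choice (inH? F ℓ)) F ℓ Y
    ρ^-unfold ℓ ℓ<3p F Y Y∈F rewrite ρ^-≡ ρ ℓ Y | inH?-resp (facet Y) F ℓ Y∈F =
      Rho.facet-independent (choice (inH? F ℓ)) (facet Y) ℓ ℓ<3p F Y Y∈F (≈Λ-refl (facet Y))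

    module AtLevel (ℓ : ℕ) (ℓ<3p : ℓ ℕ.< m₃ₚ) where

      ρ^-preserves : ∀ Y → facet (ρ^ ρ ℓ Y) ≈Λ facet Y
      ρ^-preserves Y = ≈Λ-trans (t (ρ^ ρ ℓ Y)) (t (ρ c (facet Y) ℓ Y)) (facet Y) (proj₂ (proj₂ (ρ^-unfold ℓ ℓ<3p (facet Y) Y (≈Λ-refl (facet Y)))))
                                  (Rho.preserves c (facet Y) ℓ ℓ<3p Y (≈Λ-refl (facet Y)))
        where
        c : Fin 2
        c = choice (inH? (facet Y) ℓ)

      ρ^-equivariant : ∀ F → Equivariant F (ρ^ ρ ℓ)
      ρ^-equivariant F = record
        { respects = λ Ψ Ψ' Ψ∈F Ψ≈Ψ' → begin
            ρ^ ρ ℓ Ψ  ≈⟨ ρ^-unfold ℓ ℓ<3p F Ψ Ψ∈F ⟩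
            ρ c F ℓ Ψ  ≈⟨ P.respects Ψ Ψ' Ψ∈F Ψ≈Ψ' ⟩
            ρ c F ℓ Ψ' ≈⟨ ρ^-unfold ℓ ℓ<3p F Ψ' (≈Λ-trans (t Ψ') (t Ψ) F (≈Λ-sym (t Ψ) (t Ψ') (proj₂ (proj₂ Ψ≈Ψ'))) Ψ∈F) ⟨
            ρ^ ρ ℓ Ψ' ∎
        ; commutes = λ Ψ Ψ∈F m → begin
            ρ^ ρ ℓ (r m Ψ)  ≈⟨ ρ^-unfold ℓ ℓ<3p F (r m Ψ) (subst (_≈Λ F) (sym (facet-r m Ψ)) Ψ∈F) ⟩
            ρ c F ℓ (r m Ψ) ≈⟨ P.commutes Ψ Ψ∈F m ⟩
            r m (ρ c F ℓ Ψ) ≈⟨ r-cong m _ _ (ρ^-unfold ℓ ℓ<3p F Ψ Ψ∈F) ⟨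
            r m (ρ^ ρ ℓ Ψ)  ∎
        }
        where
        open FlagReasoning
        c : Fin 2
        c = choice (inH? F ℓ)
        module P = Equivariant (Rho.equivariant c F ℓ ℓ<3p)

      ρ^-involutive : ∀ Y → ρ^ ρ ℓ (ρ^ ρ ℓ Y) ≈F Y
      ρ^-involutive Y = begin
        ρ^ ρ ℓ (ρ^ ρ ℓ Y) ≈⟨ ρ^-unfold ℓ ℓ<3p F (ρ^ ρ ℓ Y) (ρ^-preserves Y) ⟩
        ρ c F ℓ (ρ^ ρ ℓ Y) ≈⟨ Equivariant.respects (Rho.equivariant c F ℓ ℓ<3p) _ _ (ρ^-preserves Y)
                                (ρ^-unfold ℓ ℓ<3p F Y (≈Λ-refl F)) ⟩
        ρ c F ℓ (ρ c F ℓ Y) ≈⟨ Rho.involutive c F ℓ ℓ<3p Y (≈Λ-refl F) ⟩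
        Y ∎
        where
        open FlagReasoning
        F : Facet
        F = facet Y
        c : Fin 2
        c = choice (inH? F ℓ)

    ρ^-outside-H : ∀ ℓ → ℓ ℕ.< m₃ₚ → ∀ F Y → facet Y ≈Λ F → inH? F ℓ ≡ false → ρ^ ρ ℓ Y ≈F ρ Fin.zero F ℓ Y
    ρ^-outside-H ℓ ℓ<3p F Y Y∈F ∉H = subst (λ b → ρ^ ρ ℓ Y ≈F ρ (choice b) F ℓ Y) ∉H (ρ^-unfold ℓ ℓ<3p F Y Y∈F)

  -- The level ℓ

  dec-inc : ∀ ℓ → ℓ ℕ.< m₃ₚ → dec (inc ℓ) ≡ ℓ
  dec-inc ℓ = [[1+m]%d+[d∸1]]%d≡m ℓ m₃ₚ

  inc-dec : ∀ ℓ → ℓ ℕ.< m₃ₚ → inc (dec ℓ) ≡ ℓ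
  inc-dec ℓ = [1+[m+[d∸1]]%d]%d≡m ℓ m₃ₚ

  inc<3p : ∀ ℓ → inc ℓ ℕ.< m₃ₚ
  inc<3p ℓ = m%n<n (suc ℓ) m₃ₚ

  dec<3p : ∀ ℓ → dec ℓ ℕ.< m₃ₚ
  dec<3p ℓ = m%n<n (ℓ + (m₃ₚ ℕ.∸ 1)) m₃ₚ

  inc-residue : ∀ ℓ → inc ℓ ℕ.% 3 ≡ (ℓ ℕ.% 3 + 1) ℕ.% 3
  inc-residue ℓ = trans ([m%3p]%3≡m%3 (suc ℓ) p)
    (trans (cong (ℕ._% 3) (ℕ.+-comm 1 ℓ)) (sym ([m%d+n]%d≡[m+n]%d ℓ 1 3)))

  dec-residue : ∀ ℓ → dec ℓ ℕ.% 3 ≡ (ℓ ℕ.% 3 + 2) ℕ.% 3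
  dec-residue ℓ = trans ([m%3p]%3≡m%3 (ℓ + (m₃ₚ ℕ.∸ 1)) p) ([m+[3p∸1]]%3≡[m%3+2]%3 ℓ p)

  -- The level update of ξₙ₊₁, where e₀, e₁, e₃ tell whether the facet is F₀, F₁, F₃; the
  -- residue r of ℓ modulo 3 is a separate argument so that proofs can case-split on it.
  level-step : Bool → Bool → Bool → ℕ → ℕ → ℕ
  level-step e₀ e₁ e₃ r ℓ =
    if (e₁ ∧ r == 0) ∨ (e₃ ∧ r == 1) ∨ (e₀ ∧ r == 2) then inc ℓ
    else if (e₀ ∧ r == 0) ∨ (e₁ ∧ r == 1) ∨ (e₃ ∧ r == 2) then dec ℓ
    else ℓ

  AtMostOne : Bool → Bool → Bool → Set
  AtMostOne e₀ e₁ e₃ = ¬ (T e₀ × T e₁) × ¬ (T e₀ × T e₃) × ¬ (T e₁ × T e₃)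

  level-step-involutive : ∀ e₀ e₁ e₃ → AtMostOne e₀ e₁ e₃ → ∀ ℓ → ℓ ℕ.< m₃ₚ →
    let ℓ' = level-step e₀ e₁ e₃ (ℓ ℕ.% 3) ℓ in level-step e₀ e₁ e₃ (ℓ' ℕ.% 3) ℓ' ≡ ℓ
  level-step-involutive e₀ e₁ e₃ one ℓ ℓ<3p = go e₀ e₁ e₃ one (ℓ ℕ.% 3) refl
    where
    go : ∀ e₀ e₁ e₃ → AtMostOne e₀ e₁ e₃ → ∀ r → ℓ ℕ.% 3 ≡ r →
         let ℓ' = level-step e₀ e₁ e₃ r ℓ in level-step e₀ e₁ e₃ (ℓ' ℕ.% 3) ℓ' ≡ ℓ
    go true  true  _     (¬01 , _ , _) _ _ = ⊥-elim (¬01 (tt , tt))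
    go true  false true  (_ , ¬03 , _) _ _ = ⊥-elim (¬03 (tt , tt))
    go false true  true  (_ , _ , ¬13) _ _ = ⊥-elim (¬13 (tt , tt))
    go false false false _ _ _ = refl
    go true  false false _ 0 r≡ rewrite dec-residue ℓ | r≡ = inc-dec ℓ ℓ<3p
    go true  false false _ 1 r≡ rewrite r≡ = refl
    go true  false false _ 2 r≡ rewrite inc-residue ℓ | r≡ = dec-inc ℓ ℓ<3p
    go false true  false _ 0 r≡ rewrite inc-residue ℓ | r≡ = dec-inc ℓ ℓ<3p
    go false true  false _ 1 r≡ rewrite dec-residue ℓ | r≡ = inc-dec ℓ ℓ<3p
    go false true  false _ 2 r≡ rewrite r≡ = refl
    go false false true  _ 0 r≡ rewrite r≡ = refl
    go false false true  _ 1 r≡ rewrite inc-residue ℓ | r≡ = dec-inc ℓ ℓ<3p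
    go false false true  _ 2 r≡ rewrite dec-residue ℓ | r≡ = inc-dec ℓ ℓ<3p
    go _ _ _ _ (suc (suc (suc r))) r≡ = ⊥-elim (ℕ.<⇒≱ (m%n<n ℓ 3) (subst (3 ℕ.≤_) (sym r≡) (s≤s (s≤s (s≤s z≤n)))))

  level-step-moves-only-on-switching : ∀ e₀ e₁ e₃ r ℓ → level-step e₀ e₁ e₃ r ℓ ≡ ℓ ⊎ T e₀ ⊎ T e₁ ⊎ T e₃
  level-step-moves-only-on-switching true  _     _     _ _ = inj₂ (inj₁ tt)
  level-step-moves-only-on-switching false true  _     _ _ = inj₂ (inj₂ (inj₁ tt))
  level-step-moves-only-on-switching false false true  _ _ = inj₂ (inj₂ (inj₂ tt))
  level-step-moves-only-on-switching false false false _ _ = inj₁ refl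

  level-step<3p : ∀ e₀ e₁ e₃ r ℓ → ℓ ℕ.< m₃ₚ → level-step e₀ e₁ e₃ r ℓ ℕ.< m₃ₚ
  level-step<3p e₀ e₁ e₃ r ℓ ℓ<3p with (e₁ ∧ r == 0) ∨ (e₃ ∧ r == 1) ∨ (e₀ ∧ r == 2)
  ... | true = inc<3p ℓ
  ... | false with (e₀ ∧ r == 0) ∨ (e₁ ∧ r == 1) ∨ (e₃ ∧ r == 2)
  ...   | true  = dec<3p ℓ
  ...   | false = ℓ<3p

  facet-is : Flag → ℤ → Bool
  facet-is Φ i = facet Φ ≈Λ? F_ i

  shifted-level : Flag → ℕ → ℕ
  shifted-level Φ ℓ = level-step (facet-is Φ (+ 0)) (facet-is Φ (+ 1)) (facet-is Φ (+ 3)) (ℓ ℕ.% 3) ℓ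

  ξₙ₊₁-unfold : ∀ ρ Φ ℓ → ξₙ₊₁ ρ (Φ , ℓ) ≡ (ρ^ ρ ℓ (r₀ Φ) , shifted-level Φ ℓ)
  ξₙ₊₁-unfold ρ Φ ℓ = if-pair ((at (+ 1) ∧ ℓ ≡₃ 0) ∨ (at (+ 3) ∧ ℓ ≡₃ 1) ∨ (at (+ 0) ∧ ℓ ≡₃ 2))
                              ((at (+ 0) ∧ ℓ ≡₃ 0) ∨ (at (+ 1) ∧ ℓ ≡₃ 1) ∨ (at (+ 3) ∧ ℓ ≡₃ 2))
                              (ρ^ ρ ℓ (r₀ Φ)) (inc ℓ) (dec ℓ) ℓ
    where
    at : ℤ → Bool
    at = facet-is Φ

  shifted-level-resp : ∀ Φ Ψ ℓ → facet Φ ≈Λ facet Ψ → shifted-level Φ ℓ ≡ shifted-level Ψ ℓ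
  shifted-level-resp Φ Ψ ℓ Φ≈Ψ
    rewrite ≈Λ?-resp (facet Φ) (facet Ψ) (F_ (+ 0)) Φ≈Ψ
          | ≈Λ?-resp (facet Φ) (facet Ψ) (F_ (+ 1)) Φ≈Ψ
          | ≈Λ?-resp (facet Φ) (facet Ψ) (F_ (+ 3)) Φ≈Ψ = refl

  -- The facets F₀, F₁, F₃ and the vertex X_H

  ZeroOrMinusOne : ∀ {m} → (Fin m → ℤ) → Set
  ZeroOrMinusOne ε = ∀ j → ε j ≡ + 0 ⊎ ε j ≡ -[1+ 0 ]

  epsilons-entries : ∀ m → All ZeroOrMinusOne (epsilons m)
  epsilons-entries zero    = (λ ()) ∷ []
  epsilons-entries (suc m) = All.concat⁺ (All.map⁺ (All.map extend (epsilons-entries m)))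
    where
    extend : ∀ {ε} → ZeroOrMinusOne ε → All ZeroOrMinusOne _
    extend ε∈ = (λ { Fin.zero → inj₁ refl ; (Fin.suc j) → ε∈ j }) ∷ (λ { Fin.zero → inj₂ refl ; (Fin.suc j) → ε∈ j }) ∷ []

  data Switching : ℤ → Set where
    at0 : Switching (+ 0)
    at1 : Switching (+ 1)
    at3 : Switching (+ 3)

  switching∈I₇ : ∀ {i} → Switching i → i ∈ I₇
  switching∈I₇ at0 = here refl
  switching∈I₇ at1 = there (here refl)
  switching∈I₇ at3 = there (there (there (there (there (here refl)))))

  module _ (10<a : 10 ℕ.< a) where

    ≉Λ-by-small-coordinate : ∀ u v j m → u j ℤ.- v j ≡ + m → 0 ℕ.< m → m ℕ.≤ 10 → ¬ (u ≈Λ v)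
    ≉Λ-by-small-coordinate u v j m eq 0<m m≤10 = small-coordinate⇒∉Λ (u ⊖ v) j m eq 0<m (ℕ.≤-<-trans m≤10 10<a)

    F₁≉F₀ : ¬ (F_ (+ 1) ≈Λ F_ (+ 0))
    F₁≉F₀ = ≉Λ-by-small-coordinate (F_ (+ 1)) (F_ (+ 0)) Fin.zero 1 refl (s≤s z≤n) (ℕ.m≤m+n 1 9)

    F₃≉F₀ : ¬ (F_ (+ 3) ≈Λ F_ (+ 0))
    F₃≉F₀ = ≉Λ-by-small-coordinate (F_ (+ 3)) (F_ (+ 0)) Fin.zero 3 refl (s≤s z≤n) (ℕ.m≤m+n 3 7)

    F₃≉F₁ : ¬ (F_ (+ 3) ≈Λ F_ (+ 1))
    F₃≉F₁ = ≉Λ-by-small-coordinate (F_ (+ 3)) (F_ (+ 1)) Fin.zero 2 refl (s≤s z≤n) (ℕ.m≤m+n 2 8)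

    switching-at-most-one : ∀ F → AtMostOne (F ≈Λ? F_ (+ 0)) (F ≈Λ? F_ (+ 1)) (F ≈Λ? F_ (+ 3))
    switching-at-most-one F =
      (λ (F≈F₀ , F≈F₁) → F₁≉F₀ (via (+ 1) (+ 0) F≈F₁ F≈F₀)) ,
      (λ (F≈F₀ , F≈F₃) → F₃≉F₀ (via (+ 3) (+ 0) F≈F₃ F≈F₀)) ,
      (λ (F≈F₁ , F≈F₃) → F₃≉F₁ (via (+ 3) (+ 1) F≈F₃ F≈F₁))
      where
      via : ∀ i j → F ≈Λ F_ i → F ≈Λ F_ j → F_ i ≈Λ F_ j
      via i j F≈Fᵢ F≈Fⱼ = ≈Λ-trans (F_ i) F (F_ j) (≈Λ-sym F (F_ i) F≈Fᵢ) F≈Fⱼ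

    -- The second coordinate separates F₀, F₁, F₃ (second coordinates 0, 2, 6) from the
    -- facets at X_H (second coordinate -3 or -4).
    switching-∉X_H : ∀ {i} → Switching i → ∀ ε → ZeroOrMinusOne ε → ¬ (F_ i ≈Λ (cH ⊕ ε))
    switching-∉X_H {i} s ε ε∈ with gap s (ε second) (ε∈ second)
      where
      second : Fin n
      second = Fin.suc Fin.zero
      gap : ∀ {i} → Switching i → (e : ℤ) → e ≡ + 0 ⊎ e ≡ -[1+ 0 ] →
            Σ ℕ λ m → F_ i second ℤ.- (cH second ℤ.+ e) ≡ + m × 0 ℕ.< m × m ℕ.≤ 10
      gap at0 _ (inj₁ refl) = 3  , refl , s≤s z≤n , ℕ.m≤m+n 3 7
      gap at0 _ (inj₂ refl) = 4  , refl , s≤s z≤n , ℕ.m≤m+n 4 6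
      gap at1 _ (inj₁ refl) = 5  , refl , s≤s z≤n , ℕ.m≤m+n 5 5
      gap at1 _ (inj₂ refl) = 6  , refl , s≤s z≤n , ℕ.m≤m+n 6 4
      gap at3 _ (inj₁ refl) = 9  , refl , s≤s z≤n , ℕ.m≤m+n 9 1
      gap at3 _ (inj₂ refl) = 10 , refl , s≤s z≤n , ℕ.≤-refl
    ... | m , eq , 0<m , m≤10 = ≉Λ-by-small-coordinate (F_ i) (cH ⊕ ε) (Fin.suc Fin.zero) m eq 0<m m≤10

    switching-∉H : ∀ {i} → Switching i → ∀ F ℓ → F ≈Λ F_ i → inH? F ℓ ≡ false
    switching-∉H {i} s F ℓ F≈Fᵢ = cong (_∧ (ℓ == 1)) (T-extensional {incXH? F} {false} F∉X_H λ ())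
      where
      F∉X_H : T (incXH? F) → ⊥
      F∉X_H F∈X_H with All.lookupAny (epsilons-entries n) (T-anyL _ (epsilons n) F∈X_H)
      ... | ε∈ , F≈ε = switching-∉X_H s _ ε∈ (≈Λ-trans (F_ i) F _ (≈Λ-sym F (F_ i) F≈Fᵢ) F≈ε)

    shifted-level-involutive : ∀ Φ Ψ ℓ → ℓ ℕ.< m₃ₚ → facet Ψ ≈Λ facet Φ → shifted-level Ψ (shifted-level Φ ℓ) ≡ ℓ
    shifted-level-involutive Φ Ψ ℓ ℓ<3p Ψ≈Φ = trans (shifted-level-resp Ψ Φ _ Ψ≈Φ)
      (level-step-involutive (facet-is Φ (+ 0)) (facet-is Φ (+ 1)) (facet-is Φ (+ 3))
                             (switching-at-most-one (facet Φ)) ℓ ℓ<3p)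

    -- The relations

    module _ (root : Facet → ℕ → Flag) (root-spec : RootSpec root)
             (ρ : Fin 2 → Facet → ℕ → Flag → Flag) (ρ-spec : RhoSpec root ρ) where

      open Reflections root root-spec ρ ρ-spec

      ρ^-shifted-level : ∀ Φ ℓ → ℓ ℕ.< m₃ₚ → ∀ Y → facet Y ≈Λ facet Φ → ρ^ ρ (shifted-level Φ ℓ) Y ≈F ρ^ ρ ℓ Y
      ρ^-shifted-level Φ ℓ ℓ<3p Y Y∈F = by-cases (level-step-moves-only-on-switching
                                           (facet-is Φ (+ 0)) (facet-is Φ (+ 1)) (facet-is Φ (+ 3)) (ℓ ℕ.% 3) ℓ)
        where
        open FlagReasoning
        F : Facet
        F = facet Φ
        ℓ' : ℕ
        ℓ' = shifted-level Φ ℓ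
        ℓ'<3p : ℓ' ℕ.< m₃ₚ
        ℓ'<3p = level-step<3p (facet-is Φ (+ 0)) (facet-is Φ (+ 1)) (facet-is Φ (+ 3)) (ℓ ℕ.% 3) ℓ ℓ<3p
        on-switching : ∀ {i} → Switching i → F ≈Λ F_ i → ρ^ ρ ℓ' Y ≈F ρ^ ρ ℓ Y
        on-switching s F≈Fᵢ = begin
          ρ^ ρ ℓ' Y        ≈⟨ ρ^-outside-H ℓ' ℓ'<3p F Y Y∈F (switching-∉H s F ℓ' F≈Fᵢ) ⟩
          ρ Fin.zero F ℓ' Y ≈⟨ ρ-level-independent Fin.zero (switching∈I₇ s) F≈Fᵢ ℓ<3p ℓ'<3p Y Y∈F ⟩
          ρ Fin.zero F ℓ Y  ≈⟨ ρ^-outside-H ℓ ℓ<3p F Y Y∈F (switching-∉H s F ℓ F≈Fᵢ) ⟨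
          ρ^ ρ ℓ Y         ∎
        by-cases : ℓ' ≡ ℓ ⊎ F ≈Λ F_ (+ 0) ⊎ F ≈Λ F_ (+ 1) ⊎ F ≈Λ F_ (+ 3) → ρ^ ρ ℓ' Y ≈F ρ^ ρ ℓ Y
        by-cases (inj₁ ℓ'≡ℓ)               = subst (λ l → ρ^ ρ l Y ≈F ρ^ ρ ℓ Y) (sym ℓ'≡ℓ) (≈F-refl (ρ^ ρ ℓ Y))
        by-cases (inj₂ (inj₁ F≈F₀))        = on-switching at0 F≈F₀
        by-cases (inj₂ (inj₂ (inj₁ F≈F₁))) = on-switching at1 F≈F₁
        by-cases (inj₂ (inj₂ (inj₂ F≈F₃))) = on-switching at3 F≈F₃

      ξₙ₊₁-involutive : ∀ z → Elt z → ξₙ₊₁ ρ (ξₙ₊₁ ρ z) ≈ z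
      ξₙ₊₁-involutive (Φ , ℓ) (_ , ℓ<3p) =
        subst (λ z → ξₙ₊₁ ρ z ≈ (Φ , ℓ)) (sym (ξₙ₊₁-unfold ρ Φ ℓ))
          (subst (_≈ (Φ , ℓ)) (sym (ξₙ₊₁-unfold ρ Ψ (shifted-level Φ ℓ)))
            (flags , shifted-level-involutive Φ Ψ ℓ ℓ<3p Ψ∈F))
        where
        open FlagReasoning
        open AtLevel ℓ ℓ<3p
        Ψ : Flag
        Ψ = ρ^ ρ ℓ (r₀ Φ)
        Ψ∈F : facet Ψ ≈Λ facet Φ
        Ψ∈F = ρ^-preserves (r₀ Φ)
        flags : ρ^ ρ (shifted-level Φ ℓ) (r₀ Ψ) ≈F Φ
        flags = begin
          ρ^ ρ (shifted-level Φ ℓ) (r₀ Ψ) ≈⟨ ρ^-shifted-level Φ ℓ ℓ<3p (r₀ Ψ) Ψ∈F ⟩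
          ρ^ ρ ℓ (r₀ Ψ)                  ≈⟨ Equivariant.commutes (ρ^-equivariant (facet Φ)) Ψ Ψ∈F Fin.zero ⟩
          r₀ (ρ^ ρ ℓ Ψ)                  ≈⟨ r-cong Fin.zero (ρ^ ρ ℓ Ψ) (r₀ Φ) (ρ^-involutive (r₀ Φ)) ⟩
          r₀ (r₀ Φ)                      ≈⟨ r-involutive Fin.zero Φ ⟩
          Φ                              ∎

      ξᵢ⁻¹ξₙ₊₁-involutive : ∀ (i : Fin N) z w₁ w₂ → Elt z → Elt w₁ → Elt w₂ →
                            ξ ρ i w₁ ≈ ξₙ₊₁ ρ z → ξ ρ i w₂ ≈ ξₙ₊₁ ρ w₁ → w₂ ≈ z
      ξᵢ⁻¹ξₙ₊₁-involutive i (Φ , ℓ) (Φ₁ , ℓ₁) (Φ₂ , ℓ₂) (_ , ℓ<3p) _ _ step₁ step₂ = flags , levels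
        where
        open FlagReasoning
        open AtLevel ℓ ℓ<3p
        rᵢ : Flag → Flag
        rᵢ = r (Fin.suc i)
        Ψ : Flag
        Ψ = ρ^ ρ ℓ (r₀ Φ)
        Ψ∈F : facet Ψ ≈Λ facet Φ
        Ψ∈F = ρ^-preserves (r₀ Φ)
        unfolded₁ : (r₀ (rᵢ Φ₁) , ℓ₁) ≈ (Ψ , shifted-level Φ ℓ)
        unfolded₁ = subst (ξ ρ i (Φ₁ , ℓ₁) ≈_) (ξₙ₊₁-unfold ρ Φ ℓ) step₁
        unfolded₂ : (r₀ (rᵢ Φ₂) , ℓ₂) ≈ (ρ^ ρ ℓ₁ (r₀ Φ₁) , shifted-level Φ₁ ℓ₁)
        unfolded₂ = subst (ξ ρ i (Φ₂ , ℓ₂) ≈_) (ξₙ₊₁-unfold ρ Φ₁ ℓ₁) step₂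
        r₀rᵢΦ₁≈Ψ : r₀ (rᵢ Φ₁) ≈F Ψ
        r₀rᵢΦ₁≈Ψ = proj₁ unfolded₁
        ℓ₁≡ : ℓ₁ ≡ shifted-level Φ ℓ
        ℓ₁≡ = proj₂ unfolded₁
        Φ₁≈ : Φ₁ ≈F rᵢ (r₀ Ψ)
        Φ₁≈ = r-transpose (Fin.suc i) Φ₁ (r₀ Ψ) (r-transpose Fin.zero (rᵢ Φ₁) Ψ r₀rᵢΦ₁≈Ψ)
        Φ₁∈F : facet Φ₁ ≈Λ facet Φ
        Φ₁∈F = ≈Λ-trans (t Φ₁) (t Ψ) (t Φ) (proj₂ (proj₂ Φ₁≈)) Ψ∈F
        r₀rᵢr₀ : Word
        r₀rᵢr₀ = Fin.zero ∷ Fin.suc i ∷ Fin.zero ∷ []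
        r₀rᵢΦ₂≈r₀rᵢΦ : r₀ (rᵢ Φ₂) ≈F r₀ (rᵢ Φ)
        r₀rᵢΦ₂≈r₀rᵢΦ = begin
          r₀ (rᵢ Φ₂)                       ≈⟨ proj₁ unfolded₂ ⟩
          ρ^ ρ ℓ₁ (r₀ Φ₁)                  ≈⟨ subst (λ l → ρ^ ρ l (r₀ Φ₁) ≈F ρ^ ρ ℓ (r₀ Φ₁)) (sym ℓ₁≡)
                                                (ρ^-shifted-level Φ ℓ ℓ<3p (r₀ Φ₁) Φ₁∈F) ⟩
          ρ^ ρ ℓ (r₀ Φ₁)                   ≈⟨ Equivariant.respects (ρ^-equivariant (facet Φ)) (r₀ Φ₁) (act r₀rᵢr₀ Ψ) Φ₁∈F
                                                (r-cong Fin.zero Φ₁ (rᵢ (r₀ Ψ)) Φ₁≈) ⟩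
          ρ^ ρ ℓ (act r₀rᵢr₀ Ψ)            ≈⟨ equivariant-act (ρ^-equivariant (facet Φ)) r₀rᵢr₀ Ψ Ψ∈F ⟩
          act r₀rᵢr₀ (ρ^ ρ ℓ Ψ)            ≈⟨ act-cong r₀rᵢr₀ (ρ^ ρ ℓ Ψ) (r₀ Φ) (ρ^-involutive (r₀ Φ)) ⟩
          r₀ (rᵢ (r₀ (r₀ Φ)))              ≈⟨ act-cong (Fin.zero ∷ Fin.suc i ∷ []) (r₀ (r₀ Φ)) Φ (r-involutive Fin.zero Φ) ⟩
          r₀ (rᵢ Φ)                        ∎
        levels : ℓ₂ ≡ ℓ
        levels = trans (proj₂ unfolded₂)
                       (trans (cong (shifted-level Φ₁) ℓ₁≡) (shifted-level-involutive Φ Φ₁ ℓ ℓ<3p Φ₁∈F))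
        flags : Φ₂ ≈F Φ
        flags = r-injective (Fin.suc i) Φ₂ Φ (r-injective Fin.zero (rᵢ Φ₂) (rᵢ Φ) r₀rᵢΦ₂≈r₀rᵢΦ)

proposition6p8 : (M : ℕ) → (k : KType) →
                 (a : ℕ) .{{_ : NonZero a}} → 6 * (2 + M) + 1 ≤ a →
                 (p : ℕ) .{{_ : NonZero p}} →
                 Setting.Claim M k a p
proposition6p8 M k a 6n+1≤a p root root-spec ρ ρ-spec =
  ξₙ₊₁-involutive     M k a p 10<a root root-spec ρ ρ-spec ,
  ξᵢ⁻¹ξₙ₊₁-involutive M k a p 10<a root root-spec ρ ρ-spec
  where
  13≤a : 13 ≤ a
  13≤a = ℕ.≤-trans (ℕ.+-monoˡ-≤ 1 (ℕ.*-monoʳ-≤ 6 (ℕ.m≤m+n 2 M))) 6n+1≤a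
  10<a : 10 ℕ.< a
  10<a = ℕ.≤-trans (ℕ.m≤m+n 11 2) 13≤a
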